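{- Let $\eta,\eta'\in\Omega^*$. Then $\nu_{\eta'}\ll\nu_{\eta}$ if and only if $\eta'\in o_-(\eta)$.
   Context: $\mathbb{N}=\{1,2,3,\dots\}$, $\beta\mathbb{N}$ is its Stone–Čech compactification and $\mathbb{N}^*=\beta\mathbb{N}\setminus\mathbb{N}$, whose points are the free ultrafilters on $\mathbb{N}$. Let $\tau:\beta\mathbb{N}\to\beta\mathbb{N}$ be the continuous extension of $n\mapsto n+1$; its restriction to $\mathbb{N}^*$ is a homeomorphism of $\mathbb{N}^*$ onto itself. $\Omega^*$ is the quotient space of $\mathbb{N}^*\times[0,1]$ obtained by identifying $(\omega,1)$ with $(\tau\omega,0)$ for all $\omega\in\mathbb{N}^*$. For $s\in\mathbb{R}$, the homeomorphism $\phi^s:\Omega^*\to\Omega^*$ is $\phi^s(\omega,t)=(\tau^{[t+s]}\omega,\ t+s-[t+s])$, where $[x]$ is the largest integer not exceeding $x$. Put $o_-(\eta)=\{\phi^{ -s}(\eta): s\ge 0\}$. For $\eta=(\omega,t)\in\Omega^*$, with $\theta=2^t$, $\nu_\eta$ is the finitely additive probability measure on $\mathcal{P}(\mathbb{N})$ given by $\nu_\eta(A)=\omega\text{ - }\lim_n \frac{|A\cap\{1,\dots,[\theta\cdot 2^n]\}|}{\theta\cdot 2^n}$, the limit being taken along the ultrafilter $\omega$. For finitely additive probability measures $\mu,\nu$ on $\mathcal{P}(\mathbb{N})$, $\nu\ll\mu$ means that for every $\varepsilon>0$ there is $\delta>0$ such that for all $A\in\mathcal{P}(\mathbb{N})$,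 $\mu(A)<\delta$ implies $\nu(A)<\varepsilon$. -}

module Defs where

open import Axiom.ExcludedMiddle using (ExcludedMiddle)
open import Data.Empty using (⊥-elim)
open import Data.Integer.Base as ℤ using (ℤ; -[1+_])
import Data.Integer.Properties as ℤ
open import Data.List.Base using (filter; length; applyUpTo)
open import Data.List.Properties using (length-filter; length-applyUpTo)
open import Data.Nat.Base as ℕ using (ℕ; zero; suc; NonZero; nonZero)
import Data.Nat.Properties as ℕ
open import Data.Product using (_×_; _,_; ∃; proj₁; proj₂)
open import Data.Rational as ℚ using (ℚ; 0ℚ; 1ℚ; ½; ↥_; ↧ₙ_)
import Data.Rational.Properties as ℚ
open import Data.Rational.Solver using (module +-*-Solver)
import Data.Rational.Unnormalised as ℚᵘ
import Data.Rational.Unnormalised.Properties as ℚᵘ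
open import Data.Sum using (_⊎_; inj₁; inj₂)
open import Level using (0ℓ) renaming (suc to lsuc)
open import Relation.Binary.Construct.Closure.Equivalence using (EqClosure)
open import Relation.Binary.Core using (Rel)
open import Relation.Binary.PropositionalEquality
  using (_≡_; refl; sym; trans; cong; subst)
open import Relation.Nullary using (¬_; yes; no)
open import Relation.Unary
  using (Pred; _∈_; _∉_; _⊆_; _≐_; _∩_; ∁; ｛_｝; Satisfiable)
open import Algebra.Definitions.RawSemiring ℚ.+-*-rawSemiring
  using (_^_)

ι : ℤ → ℚ
ι z = z ℚ./ 1

ι-toℚᵘ : ∀ z → ℚ.toℚᵘ (ι z) ℚᵘ.≃ ℚᵘ.mkℚᵘ z 0
ι-toℚᵘ z = ℚ.toℚᵘ-fromℚᵘ (ℚᵘ.mkℚᵘ z 0)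

ι-mono : ∀ {z w} → z ℤ.≤ w → ι z ℚ.≤ ι w
ι-mono {z} {w} z≤w = ℚ.toℚᵘ-cancel-≤ (begin
  ℚ.toℚᵘ (ι z)   ≃⟨ ι-toℚᵘ z ⟩
  ℚᵘ.mkℚᵘ z 0    ≤⟨ ℚᵘ.*≤* (ℤ.*-monoʳ-≤-nonNeg (ℤ.+ 1) z≤w) ⟩
  ℚᵘ.mkℚᵘ w 0    ≃⟨ ι-toℚᵘ w ⟨
  ℚ.toℚᵘ (ι w)   ∎)
  where open ℚᵘ.≤-Reasoning

ι-suc : ∀ z → ι (z ℤ.+ ℤ.+ 1) ≡ ι z ℚ.+ 1ℚ
ι-suc z = ℚ.toℚᵘ-injective (begin
  ℚ.toℚᵘ (ι (z ℤ.+ ℤ.+ 1))             ≈⟨ ι-toℚᵘ _ ⟩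
  ℚᵘ.mkℚᵘ (z ℤ.+ ℤ.+ 1) 0              ≈⟨ ℚᵘ.*≡* (cong (ℤ._* ℤ.+ 1)
                                            (cong (ℤ._+ ℤ.+ 1) (sym (ℤ.*-identityʳ z)))) ⟩
  ℚᵘ.mkℚᵘ z 0 ℚᵘ.+ ℚᵘ.1ℚᵘ              ≈⟨ ℚᵘ.+-congˡ ℚᵘ.1ℚᵘ (ι-toℚᵘ z) ⟨
  ℚ.toℚᵘ (ι z) ℚᵘ.+ ℚᵘ.1ℚᵘ             ≈⟨ ℚ.toℚᵘ-homo-+ (ι z) 1ℚ ⟨
  ℚ.toℚᵘ (ι z ℚ.+ 1ℚ)                  ∎)
  where open import Relation.Binary.Reasoning.Setoid ℚᵘ.≃-setoid

below : ∀ q → ι (ℤ.- (ℤ.+ ℤ.∣ ↥ q ∣)) ℚ.≤ q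
below q@(ℚ.mkℚ n d-1 _) = ℚ.toℚᵘ-cancel-≤ (begin
  ℚ.toℚᵘ (ι (ℤ.- (ℤ.+ ℤ.∣ n ∣)))  ≃⟨ ι-toℚᵘ _ ⟩
  ℚᵘ.mkℚᵘ (ℤ.- (ℤ.+ ℤ.∣ n ∣)) 0   ≤⟨ ℚᵘ.*≤* (go n) ⟩
  ℚᵘ.mkℚᵘ n d-1                   ∎)
  where
  open ℚᵘ.≤-Reasoning
  go : ∀ n → (ℤ.- (ℤ.+ ℤ.∣ n ∣)) ℤ.* (ℤ.+ suc d-1) ℤ.≤ n ℤ.* ℤ.+ 1
  go (ℤ.+ zero)  = ℤ.≤-refl
  go ℤ.+[1+ m ]  = ℤ.-≤+
  go -[1+ m ]    = ℤ.*-monoˡ-≤-nonPos -[1+ m ] (ℤ.+≤+ (ℕ.s≤s ℕ.z≤n))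

above : ∀ q → q ℚ.≤ ι (ℤ.+ ℤ.∣ ↥ q ∣)
above q@(ℚ.mkℚ n d-1 _) = ℚ.toℚᵘ-cancel-≤ (begin
  ℚᵘ.mkℚᵘ n d-1                 ≤⟨ ℚᵘ.*≤* (go n) ⟩
  ℚᵘ.mkℚᵘ (ℤ.+ ℤ.∣ n ∣) 0       ≃⟨ ι-toℚᵘ _ ⟨
  ℚ.toℚᵘ (ι (ℤ.+ ℤ.∣ n ∣))      ∎)
  where
  open ℚᵘ.≤-Reasoning
  go : ∀ n → n ℤ.* ℤ.+ 1 ℤ.≤ (ℤ.+ ℤ.∣ n ∣) ℤ.* (ℤ.+ suc d-1)
  go (ℤ.+ zero)  = ℤ.≤-refl
  go ℤ.+[1+ m ]  = ℤ.*-monoˡ-≤-nonNeg ℤ.+[1+ m ] (ℤ.+≤+ (ℕ.s≤s ℕ.z≤n))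
  go -[1+ m ]    = ℤ.-≤+

q<q+1 : ∀ q → q ℚ.< q ℚ.+ 1ℚ
q<q+1 q = subst (ℚ._< q ℚ.+ 1ℚ) (ℚ.+-identityʳ q)
                (ℚ.+-monoʳ-< q (ℚ.positive⁻¹ 1ℚ))

q-1<q : ∀ q → q ℚ.- 1ℚ ℚ.< q
q-1<q q = subst (q ℚ.- 1ℚ ℚ.<_) (ℚ.+-identityʳ q)
                (ℚ.+-monoʳ-< q (ℚ.negative⁻¹ (ℚ.- 1ℚ)))

2ℚ : ℚ
2ℚ = ℤ.+ 2 ℚ./ 1

2^ℤ_ : ℤ → ℚ
2^ℤ (ℤ.+ n)   = 2ℚ ^ n
2^ℤ -[1+ n ]  = ½ ^ suc n

-- A real x is the Dedekind cut {q ∈ ℚ ∣ q < x}; equality of reals is _≃_.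
record ℝ : Set₁ where
  field
    cut        : Pred ℚ 0ℓ
    inhabited  : ∃ λ q → q ∈ cut
    proper     : ∃ λ q → q ∉ cut
    lower      : ∀ {p q} → p ℚ.< q → q ∈ cut → p ∈ cut
    rounded    : ∀ {p} → p ∈ cut → ∃ λ q → p ℚ.< q × q ∈ cut

  lower≤ : ∀ {p q} → p ℚ.≤ q → q ∈ cut → p ∈ cut
  lower≤ p≤q q∈ with rounded q∈
  ... | r , q<r , r∈ = lower (ℚ.≤-<-trans p≤q q<r) r∈

  ∉-above : ∀ {p q} → p ∈ cut → q ∉ cut → p ℚ.< q
  ∉-above p∈ q∉ = ℚ.≰⇒> λ q≤p → q∉ (lower≤ q≤p p∈)

open ℝ using (cut; inhabited; proper; lower; rounded; lower≤; ∉-above)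

infix 4 _≤_ _<_ _≃_

_≤_ : Rel ℝ 0ℓ
x ≤ y = cut x ⊆ cut y

_<_ : Rel ℝ 0ℓ
x < y = ∃ λ q → q ∉ cut x × q ∈ cut y

_≃_ : Rel ℝ 0ℓ
x ≃ y = x ≤ y × y ≤ x

fromℚ : ℚ → ℝ
fromℚ r = record
  { cut        = ℚ._< r
  ; inhabited  = r ℚ.- 1ℚ , q-1<q r
  ; proper     = r , ℚ.<-irrefl refl
  ; lower      = ℚ.<-trans
  ; rounded    = ℚ.<-dense
  }

fromℤ : ℤ → ℝ
fromℤ z = fromℚ (ι z)

fromℕ : ℕ → ℝ
fromℕ n = fromℤ (ℤ.+ n)

0ℝ 1ℝ : ℝ
0ℝ = fromℕ 0
1ℝ = fromℕ 1

sup : (S : Pred ℚ 0ℓ) → Satisfiable S → (∃ λ b → ∀ {q} → q ∈ S → q ℚ.≤ b) → ℝ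
sup S (s , s∈S) (b , S≤b) = record
  { cut        = λ q → ∃ λ p → q ℚ.< p × p ∈ S
  ; inhabited  = s ℚ.- 1ℚ , s , q-1<q s , s∈S
  ; proper     = b , λ { (p , b<p , p∈S) →
                   ℚ.<-irrefl refl (ℚ.<-≤-trans b<p (S≤b p∈S)) }
  ; lower      = λ { p<q (r , q<r , r∈S) → r , ℚ.<-trans p<q q<r , r∈S }
  ; rounded    = λ { (r , p<r , r∈S) → let q , p<q , q<r = ℚ.<-dense p<r in
                   q , p<q , r , q<r , r∈S }
  }

infixl 6 _+_ _-_
infix  8 -_
infixl 7 _·_

_+_ : ℝ → ℝ → ℝ
x + y = sup
  (λ q → ∃ λ a → ∃ λ b → a ∈ cut x × b ∈ cut y × q ≡ a ℚ.+ b)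
  (let a , a∈x = inhabited x ; b , b∈y = inhabited y in
   a ℚ.+ b , a , b , a∈x , b∈y , refl)
  (let u , u∉x = proper x ; v , v∉y = proper y in
   u ℚ.+ v , λ { (a , b , a∈x , b∈y , refl) →
     ℚ.<⇒≤ (ℚ.+-mono-< (∉-above x a∈x u∉x) (∉-above y b∈y v∉y)) })

-_ : ℝ → ℝ
- x = sup
  (λ q → ∃ λ u → u ∉ cut x × q ≡ ℚ.- u)
  (let u , u∉x = proper x in ℚ.- u , u , u∉x , refl)
  (let a , a∈x = inhabited x in
   ℚ.- a , λ { (u , u∉x , refl) →
     ℚ.<⇒≤ (ℚ.neg-antimono-< (∉-above x a∈x u∉x)) })

_-_ : ℝ → ℝ → ℝ
x - y = x + (- y)

ι-nonNeg : ∀ n → ℚ.NonNegative (ι (ℤ.+ n))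
ι-nonNeg n = ℚ.normalize-nonNeg n 1

_·_ : ℝ → ℕ → ℝ
x · n = sup
  (λ q → ∃ λ a → a ∈ cut x × q ≡ a ℚ.* ι (ℤ.+ n))
  (let a , a∈x = inhabited x in a ℚ.* ι (ℤ.+ n) , a , a∈x , refl)
  (let u , u∉x = proper x in
   u ℚ.* ι (ℤ.+ n) , λ { (a , a∈x , refl) →
     ℚ.*-monoʳ-≤-nonNeg (ι (ℤ.+ n)) {{ι-nonNeg n}} (ℚ.<⇒≤ (∉-above x a∈x u∉x)) })

0<⇒0∈ : ∀ x → 0ℝ < x → 0ℚ ∈ cut x
0<⇒0∈ x (q , q∉0 , q∈x) = lower≤ x (ℚ.≮⇒≥ q∉0) q∈x

0<⇒positive : ∀ x → 0ℝ < x → ∃ λ a → ℚ.Positive a × a ∈ cut x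
0<⇒positive x 0<x with rounded x (0<⇒0∈ x 0<x)
... | a , 0<a , a∈x = a , ℚ.positive 0<a , a∈x

-- The real k / x for x > 0, the supremum of the rationals q such that
-- q · u ≤ k for some rational upper bound u of x.
_÷_⟨_⟩ : ℕ → (x : ℝ) → 0ℝ < x → ℝ
k ÷ x ⟨ 0<x ⟩ = sup
  (λ q → ∃ λ u → u ∉ cut x × q ℚ.* u ℚ.≤ ι (ℤ.+ k))
  (let u , u∉x = proper x in
   0ℚ , u , u∉x , subst (ℚ._≤ ι (ℤ.+ k)) (sym (ℚ.*-zeroˡ u)) 0≤k)
  (bound (0<⇒positive x 0<x))
  where
  0≤k : 0ℚ ℚ.≤ ι (ℤ.+ k)
  0≤k = ℚ.nonNegative⁻¹ (ι (ℤ.+ k)) {{ι-nonNeg k}}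

  bound : (∃ λ a → ℚ.Positive a × a ∈ cut x) →
          ∃ λ b → ∀ {q} → (∃ λ u → u ∉ cut x × q ℚ.* u ℚ.≤ ι (ℤ.+ k)) → q ℚ.≤ b
  bound (a , a-pos , a∈x) = b , λ { {q} (u , u∉x , qu≤k) → ℚ.≮⇒≥ λ b<q →
      let instance
            q-nonNeg : ℚ.NonNegative q
            q-nonNeg = ℚ.nonNegative (ℚ.<⇒≤ (ℚ.≤-<-trans 0≤b b<q))
      in ℚ.<-irrefl refl (begin-strict
        ι (ℤ.+ k)                     ≡⟨ ba≡k ⟨
        b ℚ.* a                       <⟨ ℚ.*-monoˡ-<-pos a b<q ⟩
        q ℚ.* a                       ≤⟨ ℚ.*-monoˡ-≤-nonNeg q (ℚ.<⇒≤ (∉-above x a∈x u∉x)) ⟩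
        q ℚ.* u                       ≤⟨ qu≤k ⟩
        ι (ℤ.+ k)                     ∎) }
    where
    open ℚ.≤-Reasoning
    instance
      a-positive : ℚ.Positive a
      a-positive = a-pos
      a-nonZero : ℚ.NonZero a
      a-nonZero = ℚ.pos⇒nonZero a
    b : ℚ
    b = ι (ℤ.+ k) ℚ.* (ℚ.1/ a)
    ba≡k : b ℚ.* a ≡ ι (ℤ.+ k)
    ba≡k = trans (ℚ.*-assoc (ι (ℤ.+ k)) (ℚ.1/ a) a)
             (trans (cong (ι (ℤ.+ k) ℚ.*_) (ℚ.*-inverseˡ a)) (ℚ.*-identityʳ _))
    0≤b : 0ℚ ℚ.≤ b
    0≤b = ℚ.*-cancelʳ-≤-pos a (begin
      0ℚ ℚ.* a   ≡⟨ ℚ.*-zeroˡ a ⟩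
      0ℚ         ≤⟨ 0≤k ⟩
      ι (ℤ.+ k)  ≡⟨ ba≡k ⟨
      b ℚ.* a    ∎)

record 𝕀 : Set₁ where
  field
    val  : ℝ
    0≤   : 0ℝ ≤ val
    ≤1   : val ≤ 1ℝ

open 𝕀 using (val; 0≤; ≤1)

^-nonNeg : ∀ r n → 0ℚ ℚ.≤ r → 0ℚ ℚ.≤ r ^ n
^-nonNeg r zero    0≤r = ℚ.nonNegative⁻¹ 1ℚ
^-nonNeg r (suc n) 0≤r = begin
  0ℚ           ≡⟨ ℚ.*-zeroʳ r ⟨
  r ℚ.* 0ℚ     ≤⟨ ℚ.*-monoˡ-≤-nonNeg r {{ℚ.nonNegative 0≤r}} (^-nonNeg r n 0≤r) ⟩
  r ℚ.* r ^ n  ∎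
  where open ℚ.≤-Reasoning

1≤2^ : ∀ n → 1ℚ ℚ.≤ 2ℚ ^ n
1≤2^ zero    = ℚ.≤-refl
1≤2^ (suc n) = begin
  1ℚ              ≤⟨ ℚ.<⇒≤ (q<q+1 1ℚ) ⟩
  2ℚ              ≡⟨ ℚ.*-identityʳ 2ℚ ⟨
  2ℚ ℚ.* 1ℚ       ≤⟨ ℚ.*-monoˡ-≤-nonNeg 2ℚ (1≤2^ n) ⟩
  2ℚ ℚ.* 2ℚ ^ n   ∎
  where open ℚ.≤-Reasoning

2^-mono : ∀ {m n} → m ℕ.≤ n → 2ℚ ^ m ℚ.≤ 2ℚ ^ n
2^-mono {n = n} ℕ.z≤n = 1≤2^ n
2^-mono (ℕ.s≤s m≤n)   = ℚ.*-monoˡ-≤-nonNeg 2ℚ (2^-mono m≤n)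

½^≤1 : ∀ n → ½ ^ n ℚ.≤ 1ℚ
½^≤1 zero    = ℚ.≤-refl
½^≤1 (suc n) = begin
  ½ ℚ.* ½ ^ n   ≤⟨ ℚ.*-monoˡ-≤-nonNeg ½ (½^≤1 n) ⟩
  ½ ℚ.* 1ℚ      ≡⟨ ℚ.*-identityʳ ½ ⟩
  ½             ≤⟨ ℚ.toℚᵘ-cancel-≤ (ℚᵘ.*≤* (ℤ.+≤+ (ℕ.s≤s ℕ.z≤n))) ⟩
  1ℚ            ∎
  where open ℚ.≤-Reasoning

2^ℤ≤2^ : ∀ z n → z ℤ.≤ ℤ.+ n → 2^ℤ z ℚ.≤ 2ℚ ^ n
2^ℤ≤2^ (ℤ.+ m)   n (ℤ.+≤+ m≤n)  = 2^-mono m≤n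
2^ℤ≤2^ -[1+ m ]  n _            = ℚ.≤-trans (½^≤1 (suc m)) (1≤2^ n)

2^<^ : ∀ {r} → 2ℚ ℚ.< r → ∀ n → 2ℚ ^ suc n ℚ.< r ^ suc n
2^<^ {r} 2<r zero    = ℚ.*-monoˡ-<-pos 1ℚ 2<r
2^<^ {r} 2<r (suc n) = begin-strict
  2ℚ ℚ.* 2ℚ ^ suc n  <⟨ ℚ.*-monoʳ-<-pos 2ℚ (2^<^ 2<r n) ⟩
  2ℚ ℚ.* r ^ suc n   ≤⟨ ℚ.*-monoʳ-≤-nonNeg (r ^ suc n) {{ℚ.nonNegative 0≤r^}} (ℚ.<⇒≤ 2<r) ⟩
  r ℚ.* r ^ suc n    ∎
  where
  open ℚ.≤-Reasoning
  0≤r^ : 0ℚ ℚ.≤ r ^ suc n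
  0≤r^ = ^-nonNeg r (suc n) (ℚ.<⇒≤ (ℚ.<-trans (ℚ.positive⁻¹ 2ℚ) 2<r))

<1⇒↥≤↧ : ∀ q → q ℚ.< 1ℚ → ↥ q ℤ.≤ ℤ.+ ↧ₙ q
<1⇒↥≤↧ q@(ℚ.mkℚ n d-1 _) (ℚ.*<* n<d) = ℤ.<⇒≤
  (subst (ℤ._< ℤ.+ suc d-1) (ℤ.*-identityʳ n)
    (subst (n ℤ.* ℤ.+ 1 ℤ.<_) (ℤ.*-identityˡ (ℤ.+ suc d-1)) n<d))

-- 2^t is the supremum of 2^(m/n) over the rationals m/n < t, where 2^(m/n) is
-- in turn the supremum of the rationals r ≥ 0 with r^n ≤ 2^m.
2^_ : 𝕀 → ℝ
2^ t = sup
  (λ r → 0ℚ ℚ.≤ r × ∃ λ q → q ∈ cut (val t) × r ^ (↧ₙ q) ℚ.≤ 2^ℤ (↥ q))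
  (½ , ℚ.nonNegative⁻¹ ½ , ℚ.- 1ℚ , 0≤ t (ℚ.negative⁻¹ (ℚ.- 1ℚ)) , ℚ.≤-refl)
  (2ℚ , λ { {r} (_ , q@(ℚ.mkℚ _ d-1 _) , q∈t , r^n≤2^m) → ℚ.≮⇒≥ λ 2<r →
     ℚ.<-irrefl refl (ℚ.<-≤-trans (2^<^ 2<r d-1)
       (ℚ.≤-trans r^n≤2^m (2^ℤ≤2^ (↥ q) (suc d-1) (<1⇒↥≤↧ q (≤1 t q∈t))))) })

2^-positive : ∀ t → 0ℝ < 2^ t
2^-positive t = 0ℚ , ℚ.<-irrefl refl ,
  ½ , ℚ.positive⁻¹ ½ , ℚ.nonNegative⁻¹ ½ ,
  ℚ.- 1ℚ , 0≤ t (ℚ.negative⁻¹ (ℚ.- 1ℚ)) , ℚ.≤-refl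

·-positive : ∀ x n .{{_ : NonZero n}} → 0ℝ < x → 0ℝ < x · n
·-positive x n 0<x with 0<⇒positive x 0<x
... | a , a-pos , a∈x = 0ℚ , ℚ.<-irrefl refl ,
  a ℚ.* ι (ℤ.+ n) ,
  subst (ℚ._< a ℚ.* ι (ℤ.+ n)) (ℚ.*-zeroʳ a)
    (ℚ.*-monoʳ-<-pos a {{a-pos}}
      (ℚ.positive⁻¹ (ι (ℤ.+ n)) {{ℚ.normalize-pos n 1}})) ,
  a , a∈x , refl

-- Excluded middle is needed for the integer part to exist; below it is
-- supplied by an ultrafilter.
module _ (em : ExcludedMiddle 0ℓ) where

  floor-exists : ∀ x → ∃ λ z → fromℤ z ≤ x × (∀ w → fromℤ w ≤ x → w ℤ.≤ z)
  floor-exists x = search ℤ.∣ z₁ ℤ.- z₀ ∣ z₀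
      (λ q<z₀ → lower x (ℚ.<-≤-trans q<z₀ (below a)) a∈x)
      λ le → u∉x (le (ℚ.<-≤-trans u<z₁ (ι-mono z₁≤)))
    where
    a = proj₁ (inhabited x)
    a∈x = proj₂ (inhabited x)
    u = proj₁ (proper x)
    u∉x = proj₂ (proper x)
    z₀ z₁ : ℤ
    z₀ = ℤ.- (ℤ.+ ℤ.∣ ↥ a ∣)
    z₁ = (ℤ.+ ℤ.∣ ↥ u ∣) ℤ.+ ℤ.+ 1

    u<z₁ : u ℚ.< ι z₁
    u<z₁ = ℚ.≤-<-trans (above u)
      (subst (ι (ℤ.+ ℤ.∣ ↥ u ∣) ℚ.<_) (sym (ι-suc (ℤ.+ ℤ.∣ ↥ u ∣)))
             (q<q+1 (ι (ℤ.+ ℤ.∣ ↥ u ∣))))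

    i≤∣i∣ : ∀ i → i ℤ.≤ ℤ.+ ℤ.∣ i ∣
    i≤∣i∣ (ℤ.+ n)  = ℤ.≤-refl
    i≤∣i∣ -[1+ n ] = ℤ.-≤+

    z₁≤ : z₁ ℤ.≤ z₀ ℤ.+ ℤ.+ ℤ.∣ z₁ ℤ.- z₀ ∣
    z₁≤ = subst (ℤ._≤ z₀ ℤ.+ ℤ.+ ℤ.∣ z₁ ℤ.- z₀ ∣) eq
            (ℤ.+-monoʳ-≤ z₀ (i≤∣i∣ (z₁ ℤ.- z₀)))
      where
      eq : z₀ ℤ.+ (z₁ ℤ.- z₀) ≡ z₁
      eq = trans (ℤ.+-comm z₀ (z₁ ℤ.- z₀))
             (trans (ℤ.+-assoc z₁ (ℤ.- z₀) z₀)
               (trans (cong (λ i → z₁ ℤ.+ i) (ℤ.+-inverseˡ z₀)) (ℤ.+-identityʳ z₁)))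

    search : ∀ k z → fromℤ z ≤ x → ¬ (fromℤ (z ℤ.+ ℤ.+ k) ≤ x) →
             ∃ λ z → fromℤ z ≤ x × (∀ w → fromℤ w ≤ x → w ℤ.≤ z)
    search zero    z z≤x ¬ub =
      ⊥-elim (¬ub (subst (λ w → fromℤ w ≤ x) (sym (ℤ.+-identityʳ z)) z≤x))
    search (suc k) z z≤x ¬ub with em {fromℤ (z ℤ.+ ℤ.+ 1) ≤ x}
    ... | yes z+1≤x = search k (z ℤ.+ ℤ.+ 1) z+1≤x
            (λ le → ¬ub (subst (λ w → fromℤ w ≤ x) (ℤ.+-assoc z (ℤ.+ 1) (ℤ.+ k)) le))
    ... | no  z+1≰x = z , z≤x , λ w w≤x → ℤ.≮⇒≥ λ z<w →
            z+1≰x (λ q< → w≤x (ℚ.<-≤-trans q< (ι-mono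
              (subst (ℤ._≤ w) (ℤ.+-comm (ℤ.+ 1) z) (ℤ.i<j⇒suc[i]≤j z<w)))))

  floor : ℝ → ℤ
  floor x = proj₁ (floor-exists x)

  frac : ℝ → 𝕀
  frac x = record { val = x - fromℤ z ; 0≤ = 0≤x-z ; ≤1 = x-z≤1 }
    where
    open +-*-Solver
    z = floor x
    z≤x = proj₁ (proj₂ (floor-exists x))
    z-max = proj₂ (proj₂ (floor-exists x))

    neg∈ : ∀ {p} → p ℚ.< ℚ.- ι z → p ∈ cut (- fromℤ z)
    neg∈ p<-z = ℚ.- ι z , p<-z , ι z , ℚ.<-irrefl refl , refl

    0≤x-z : 0ℝ ≤ x - fromℤ z
    0≤x-z {q} q<0 =
      let h , q<h , h<0 = ℚ.<-dense q<0
          k , h<k , k<0 = ℚ.<-dense h<0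
      in h , q<h , ι z ℚ.+ k , h ℚ.- (ι z ℚ.+ k) ,
         z≤x (subst (ι z ℚ.+ k ℚ.<_) (ℚ.+-identityʳ (ι z)) (ℚ.+-monoʳ-< (ι z) k<0)) ,
         neg∈ (begin-strict
           h ℚ.- (ι z ℚ.+ k)   <⟨ ℚ.+-monoˡ-< (ℚ.- (ι z ℚ.+ k)) h<k ⟩
           k ℚ.- (ι z ℚ.+ k)   ≡⟨ solve 2 (λ z k → k :- (z :+ k) := :- z) refl (ι z) k ⟩
           ℚ.- ι z             ∎) ,
         solve 2 (λ h s → h := s :+ (h :- s)) refl h (ι z ℚ.+ k)
      where open ℚ.≤-Reasoning

    x-z≤1 : x - fromℤ z ≤ 1ℝ
    x-z≤1 {q} (_ , q<a+b , a , b , a∈x , (_ , b<-u , u , u≮z , refl) , refl) =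
      ℚ.≰⇒> λ 1≤q → ℤ.<-irrefl refl (ℤ.suc[i]≤j⇒i<j
        (subst (ℤ._≤ z) (ℤ.+-comm z (ℤ.+ 1)) (z-max (z ℤ.+ ℤ.+ 1)
          λ {p} p<z+1 → lower x (begin-strict
            p                      <⟨ p<z+1 ⟩
            ι (z ℤ.+ ℤ.+ 1)        ≡⟨ ι-suc z ⟩
            ι z ℚ.+ 1ℚ             ≤⟨ ℚ.+-mono-≤ (ℚ.≮⇒≥ u≮z) 1≤q ⟩
            u ℚ.+ q                <⟨ ℚ.+-monoʳ-< u q<a+b ⟩
            u ℚ.+ (a ℚ.+ b)        <⟨ ℚ.+-monoʳ-< u (ℚ.+-monoʳ-< a b<-u) ⟩
            u ℚ.+ (a ℚ.+ ℚ.- u)    ≡⟨ solve 2 (λ u a → u :+ (a :- u) := a) refl u a ⟩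
            a                      ∎) a∈x)))
      where open ℚ.≤-Reasoning

ℕ⁺ : Set
ℕ⁺ = ∃ λ n → NonZero n

1+_ : ℕ → ℕ⁺
1+ n = suc n , nonZero

suc⁺ : ℕ⁺ → ℕ⁺
suc⁺ (n , _) = 1+ n

𝒫 : Set₁
𝒫 = Pred ℕ⁺ 0ℓ

-- Free ultrafilters on {1,2,3,…}. That ∅ is not a member is put positively
-- (`nonempty`).
record ℕ* : Set₁ where
  field
    sets          : Pred 𝒫 0ℓ
    upward        : ∀ {A B : 𝒫} → A ⊆ B → A ∈ sets → B ∈ sets
    intersection  : ∀ {A B : 𝒫} → A ∈ sets → B ∈ sets → A ∩ B ∈ sets
    nonempty      : ∀ {A : 𝒫} → A ∈ sets → Satisfiable A
    ultra         : ∀ (A : 𝒫) → A ∈ sets ⊎ ∁ A ∈ sets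
    free          : ∀ n → ｛ n ｝ ∉ sets

open ℕ* using (sets; upward; intersection; nonempty; ultra; free)

infix 4 _≈_ _≈Ω_

_≈_ : Rel ℕ* (lsuc 0ℓ)
ω ≈ ω′ = sets ω ≐ sets ω′

-- An ultrafilter decides every proposition P, since it contains {n ∣ P} or its
-- complement, so no classical axiom has to be assumed.
decide : ℕ* → ExcludedMiddle 0ℓ
decide ω {P} with ultra ω (λ _ → P)
... | inj₁ P∈ω = yes (proj₂ (nonempty ω P∈ω))
... | inj₂ ¬P∈ω = no (proj₂ (nonempty ω ¬P∈ω))

suc⁺-injective : ∀ {m n} → suc⁺ m ≡ suc⁺ n → m ≡ n
suc⁺-injective {suc m , _} {suc n , _} refl = refl

one-or-suc : ∀ m → m ≡ 1+ 0 ⊎ ∃ λ n → suc⁺ n ≡ m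
one-or-suc (suc zero    , _) = inj₁ refl
one-or-suc (suc (suc n) , _) = inj₂ (1+ n , refl)

suc⁺[_] : 𝒫 → 𝒫
suc⁺[ A ] m = ∃ λ n → n ∈ A × suc⁺ n ≡ m

≢one∈ : ∀ ω → ∁ ｛ 1+ 0 ｝ ∈ sets ω
≢one∈ ω with ultra ω ｛ 1+ 0 ｝
... | inj₁ one∈ω = ⊥-elim (free ω (1+ 0) one∈ω)
... | inj₂ ∁one∈ω = ∁one∈ω

τ : ℕ* → ℕ*
τ ω = record
  { sets          = λ A → (λ n → suc⁺ n ∈ A) ∈ sets ω
  ; upward        = λ A⊆B → upward ω A⊆B
  ; intersection  = intersection ω
  ; nonempty      = λ A∈ → let n , n∈ = nonempty ω A∈ in suc⁺ n , n∈
  ; ultra         = λ A → ultra ω (λ n → suc⁺ n ∈ A)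
  ; free          = τ-free
  }
  where
  τ-free : ∀ n → (λ m → n ≡ suc⁺ m) ∉ sets ω
  τ-free n n∈ with nonempty ω n∈
  ... | m , refl = free ω m (upward ω suc⁺-injective n∈)

τ⁻¹ : ℕ* → ℕ*
τ⁻¹ ω = record
  { sets          = λ A → suc⁺[ A ] ∈ sets ω
  ; upward        = λ A⊆B → upward ω λ { (n , n∈A , eq) → n , A⊆B n∈A , eq }
  ; intersection  = λ {A} {B} A∈ B∈ → upward ω
      (λ { ((n , n∈A , eq) , (n′ , n′∈B , eq′)) →
           n , (n∈A , subst (_∈ B) (suc⁺-injective (trans eq′ (sym eq))) n′∈B) , eq })
      (intersection ω A∈ B∈)
  ; nonempty      = λ A∈ → let _ , n , n∈A , _ = nonempty ω A∈ in n , n∈A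
  ; ultra         = τ⁻¹-ultra
  ; free          = λ n n∈ → free ω (suc⁺ n) (upward ω (λ { (_ , refl , eq) → eq }) n∈)
  }
  where
  τ⁻¹-ultra : ∀ A → suc⁺[ A ] ∈ sets ω ⊎ suc⁺[ ∁ A ] ∈ sets ω
  τ⁻¹-ultra A with ultra ω suc⁺[ A ]
  ... | inj₁ A∈ = inj₁ A∈
  ... | inj₂ ∁A∈ = inj₂ (upward ω shift (intersection ω ∁A∈ (≢one∈ ω)))
    where
    shift : ∁ suc⁺[ A ] ∩ ∁ ｛ 1+ 0 ｝ ⊆ suc⁺[ ∁ A ]
    shift {m} (m∉ , m≢1) with one-or-suc m
    ... | inj₁ m≡1 = ⊥-elim (m≢1 (sym m≡1))
    ... | inj₂ (n , eq) = n , (λ n∈A → m∉ (n , n∈A , eq)) , eq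

τ⁻¹-τ : ∀ ω → τ⁻¹ (τ ω) ≈ ω
τ⁻¹-τ ω =
  (λ {A} → upward ω (λ { (n , n∈A , eq) → subst A (suc⁺-injective eq) n∈A })) ,
  upward ω (λ {m} m∈A → m , m∈A , refl)

τ-τ⁻¹ : ∀ ω → τ (τ⁻¹ ω) ≈ ω
τ-τ⁻¹ ω =
  upward ω (λ { (n , n∈A , refl) → n∈A }) ,
  λ {A} A∈ω → upward ω (shift A) (intersection ω A∈ω (≢one∈ ω))
  where
  shift : ∀ A → A ∩ ∁ ｛ 1+ 0 ｝ ⊆ suc⁺[ (λ n → suc⁺ n ∈ A) ]
  shift A {m} (m∈A , m≢1) with one-or-suc m
  ... | inj₁ m≡1 = ⊥-elim (m≢1 (sym m≡1))
  ... | inj₂ (n , refl) = n , m∈A , refl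

τ^ : ℤ → ℕ* → ℕ*
τ^ (ℤ.+ zero)     ω = ω
τ^ ℤ.+[1+ n ]     ω = τ (τ^ (ℤ.+ n) ω)
τ^ -[1+ zero ]    ω = τ⁻¹ ω
τ^ -[1+ suc n ]   ω = τ⁻¹ (τ^ -[1+ n ] ω)

Limit : ℕ* → (ℕ⁺ → ℝ) → Pred ℝ (lsuc 0ℓ)
Limit ω a L = ∀ x y → x < L → L < y → (λ n → x < a n × a n < y) ∈ sets ω

lim-exists : ∀ ω (a : ℕ⁺ → ℝ) (l u : ℝ) →
             (∀ n → l ≤ a n) → (∀ n → a n ≤ u) → ∃ (Limit ω a)
lim-exists ω a l u l≤a a≤u = L , limit
  where
  S : Pred ℚ 0ℓ
  S r = (λ n → r ∈ cut (a n)) ∈ sets ω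

  L : ℝ
  L = sup S
    (let r , r∈l = inhabited l in
     r , upward ω (λ {n} _ → l≤a n r∈l) (proj₂ (all∈ r)))
    (let b , b∉u = proper u in
     b , λ r∈S → let n , r∈an = nonempty ω r∈S in
       ℚ.<⇒≤ (∉-above u (a≤u n r∈an) b∉u))
    where
    all∈ : ℚ → ∃ λ A → A ∈ sets ω
    all∈ r with ultra ω (λ n → r ∈ cut (a n))
    ... | inj₁ A∈ = _ , A∈
    ... | inj₂ A∈ = _ , A∈

  limit : Limit ω a L
  limit x y (q , q∉x , r , q<r , r∈S) (p , p∉L , p∈y) with rounded y p∈y
  ... | p′ , p<p′ , p′∈y with ultra ω (λ n → p′ ∈ cut (a n))
  ... | inj₁ p′∈S = ⊥-elim (p∉L (p′ , p<p′ , p′∈S))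
  ... | inj₂ p′∉  = upward ω
    (λ { {n} (r∈an , p′∉an) → (q , q∉x , lower (a n) q<r r∈an) , (p′ , p′∉an , p′∈y) })
    (intersection ω r∈S p′∉)

-- Pairs representing the points of the quotient; two of them represent the
-- same point when related by _≈Ω_.
Ω* : Set₁
Ω* = ℕ* × 𝕀

data Glue : Rel Ω* (lsuc 0ℓ) where
  same  : ∀ {ω ω′ t t′} → ω ≈ ω′ → val t ≃ val t′ → Glue (ω , t) (ω′ , t′)
  glue  : ∀ {ω t t′} → val t ≃ 1ℝ → val t′ ≃ 0ℝ → Glue (ω , t) (τ ω , t′)

_≈Ω_ : Rel Ω* (lsuc 0ℓ)
_≈Ω_ = EqClosure Glue

φ : ℝ → Ω* → Ω*
φ s (ω , t) = τ^ (floor (decide ω) (val t + s)) ω , frac (decide ω) (val t + s)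

o₋ : Ω* → Pred Ω* (lsuc 0ℓ)
o₋ η η′ = ∃ λ s → 0ℝ ≤ s × η′ ≈Ω φ (- s) η

module _ (em : ExcludedMiddle 0ℓ) where

  -- |A ∩ {1,…,k}|
  count : 𝒫 → ℕ → ℕ
  count A k = length (filter (λ n → em {n ∈ A}) (applyUpTo 1+_ k))

  density : 𝒫 → (x : ℝ) → 0ℝ < x → ℝ
  density A x 0<x = count A ℤ.∣ floor em x ∣ ÷ x ⟨ 0<x ⟩

  0≤density : ∀ A x 0<x → 0ℝ ≤ density A x 0<x
  0≤density A x 0<x q<0 = let u , u∉x = proper x in
    0ℚ , q<0 , u , u∉x ,
    subst (ℚ._≤ ι (ℤ.+ k)) (sym (ℚ.*-zeroˡ u)) (ℚ.nonNegative⁻¹ (ι (ℤ.+ k)) {{ι-nonNeg k}})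
    where k = count A ℤ.∣ floor em x ∣

  density≤1 : ∀ A x 0<x → density A x 0<x ≤ 1ℝ
  density≤1 A x 0<x {q} (p , q<p , u , u∉x , pu≤k) = ℚ.≰⇒> λ 1≤q →
    ℚ.<-irrefl refl (begin-strict
      u                            ≡⟨ ℚ.*-identityˡ u ⟨
      1ℚ ℚ.* u                     <⟨ ℚ.*-monoˡ-<-pos u {{u-pos}} (ℚ.≤-<-trans 1≤q q<p) ⟩
      p ℚ.* u                      ≤⟨ pu≤k ⟩
      ι (ℤ.+ k)                    ≤⟨ ι-mono (ℤ.+≤+ k≤z) ⟩
      ι (ℤ.+ ℤ.∣ z ∣)              ≡⟨ cong ι (ℤ.0≤i⇒+∣i∣≡i 0≤z) ⟩
      ι z                          ≤⟨ ℚ.≮⇒≥ (λ u<z → u∉x (z≤x u<z)) ⟩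
      u                            ∎)
    where
    open ℚ.≤-Reasoning
    z = floor em x
    z≤x = proj₁ (proj₂ (floor-exists em x))
    k = count A ℤ.∣ z ∣

    k≤z : k ℕ.≤ ℤ.∣ z ∣
    k≤z = subst (k ℕ.≤_) (length-applyUpTo 1+_ ℤ.∣ z ∣)
            (length-filter (λ n → em {n ∈ A}) (applyUpTo 1+_ ℤ.∣ z ∣))

    0≤z : ℤ.+ 0 ℤ.≤ z
    0≤z = proj₂ (proj₂ (floor-exists em x)) (ℤ.+ 0)
            (λ q<0 → lower x q<0 (0<⇒0∈ x 0<x))

    u-pos : ℚ.Positive u
    u-pos = ℚ.positive (∉-above x (0<⇒0∈ x 0<x) u∉x)

ν : Ω* → 𝒫 → ℝ
ν (ω , t) A = proj₁ (lim-exists ω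
  (λ (n , _) → density em A (θ · 2 ℕ.^ n) (0<θ2^ n))
  0ℝ 1ℝ
  (λ (n , _) → 0≤density em A (θ · 2 ℕ.^ n) (0<θ2^ n))
  (λ (n , _) → density≤1 em A (θ · 2 ℕ.^ n) (0<θ2^ n)))
  where
  em : ExcludedMiddle 0ℓ
  em = decide ω
  θ : ℝ
  θ = 2^ t
  0<θ2^ : ∀ n → 0ℝ < θ · 2 ℕ.^ n
  0<θ2^ n = ·-positive θ (2 ℕ.^ n) {{ℕ.m^n≢0 2 n}} (2^-positive t)

infix 4 _≪_

_≪_ : Rel (𝒫 → ℝ) (lsuc 0ℓ)
ν₁ ≪ μ = ∀ ε → 0ℝ < ε → ∃ λ δ → 0ℝ < δ × (∀ A → μ A < δ → ν₁ A < ε)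

{-# OPTIONS --safe #-}

-- (⇐) If k ≥ 0 and θ′2ᵐ ≤ θ2^(m+k), then {1,…,[θ′2ᵐ]} ⊆ {1,…,[θ2^(m+k)]} and
-- θ2^(m+k) ≤ 2^(k+1)θ′2ᵐ, so ν_η′(A) ≤ 2^(k+1) ν_η(A) for η′ = (τ^(-k) ω, t′). The points of o₋(η) have
-- this form up to the gluing, which leaves ν unchanged because 2¹ = 2·2⁰.
--
-- (⇒) For a set B of exponents let A = ⋃ {(c2ⁿ, d2ⁿ] ∣ n ∈ B} with c < d < θ′. If B ∈ ω′ then
-- ν_η′(A) ≥ (d − c)/4; if for ω-most m every n ∈ B with c2ⁿ < θ2ᵐ satisfies n ≤ m − M, then
-- ν_η(A) ≤ 2·2^(-M). So absolute continuity gives M such that no B ∈ ω′ has the second property.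
-- For c = 1/2 this means that every B ∈ ω′ has one of finitely many translates in ω; intersecting B with
-- the residue class modulo M + 1 that is in ω′ makes the translate independent of B, hence
-- ω′ = τ^(-k) ω with k ≥ -1. If θ′ > 2ᵏθ (so k ≤ 0), choose c between 2ᵏθ and θ′: then c2ⁿ < θ2ᵐ forces
-- n < m − k, and a residue class B ∈ ω′ modulo a large number contradicts the choice of M.

module Submission where

open import Defs
open import Algebra.Bundles using (CommutativeRing)
open import Axiom.ExcludedMiddle using (ExcludedMiddle)
open import Data.Empty using (⊥; ⊥-elim)
open import Data.Integer.Base as ℤ using (ℤ; -[1+_])
import Data.Integer.Properties as ℤ
open import Data.List.Base using ([]; _∷_; _++_; filter; length; applyUpTo; _∷ʳ_)
open import Data.List.Properties
  using (applyUpTo-∷ʳ; filter-++; filter-accept; filter-reject; length-++)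
open import Data.Nat.Base as ℕ using (ℕ; zero; suc; NonZero)
open import Data.Nat.Coprimality as Coprimality using (Coprime; 1-coprimeTo; coprime-+)
open import Data.Nat.DivMod using (_%_; _/_; m≡m%n+[m/n]*n; [m+kn]%n≡m%n; m<n⇒m%n≡m; m%n<n)
import Data.Nat.Properties as ℕ
open import Data.Nat.Solver using () renaming (module +-*-Solver to ℕ-Solver)
open import Data.Product using (_×_; _,_; ∃; proj₁; proj₂)
open import Data.Rational as ℚ using (ℚ; 0ℚ; 1ℚ; ½; ↥_)
import Data.Rational.Properties as ℚ
open import Data.Rational.Solver using (module +-*-Solver)
import Data.Rational.Unnormalised as ℚᵘ
import Data.Rational.Unnormalised.Properties as ℚᵘ
open import Data.Sum using (_⊎_; inj₁; inj₂)
open import Function.Bundles using (_⇔_; mk⇔)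
open import Level using (0ℓ)
open import Relation.Binary.Construct.Closure.ReflexiveTransitive using (ε; _◅_; _◅◅_)
open import Relation.Binary.Construct.Closure.Symmetric using (fwd; bwd)
open import Relation.Binary.PropositionalEquality
  using (_≡_; refl; sym; trans; cong; cong₂; subst; module ≡-Reasoning)
open import Relation.Nullary using (¬_; Dec; yes; no)
open import Relation.Nullary.Decidable using (decidable-stable)
open import Relation.Unary using (Pred; _∈_; _∉_; _⊆_)
open import Algebra.Properties.Semiring.Exp
  (CommutativeRing.semiring ℚ.+-*-commutativeRing) using (_^_; ^-assocʳ)
open import Algebra.Properties.CommutativeSemiring.Exp
  (CommutativeRing.commutativeSemiring ℚ.+-*-commutativeRing) using (^-distrib-*)
open +-*-Solver using (solve; con; _:=_; _:+_; _:*_; _:-_)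
open ℕ-Solver using ()
  renaming (solve to ℕ-solve; con to ℕ-con; _:=_ to _ℕ:=_; _:+_ to _ℕ:+_; _:*_ to _ℕ:*_)
open ℝ
open 𝕀
open ℕ*

-- Rational arithmetic

<⇒≱ : ∀ {p q} → p ℚ.< q → ¬ (q ℚ.≤ p)
<⇒≱ p<q q≤p = ℚ.<-irrefl refl (ℚ.<-≤-trans p<q q≤p)

ι-+ : ∀ z w → ι (z ℤ.+ w) ≡ ι z ℚ.+ ι w
ι-+ z w = ℚ.toℚᵘ-injective (begin
  ℚ.toℚᵘ (ι (z ℤ.+ w))                 ≈⟨ ι-toℚᵘ _ ⟩
  ℚᵘ.mkℚᵘ (z ℤ.+ w) 0                  ≈⟨ ℚᵘ.*≡* (cong (ℤ._* ℤ.+ 1)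
                                            (cong₂ ℤ._+_ (sym (ℤ.*-identityʳ z)) (sym (ℤ.*-identityʳ w)))) ⟩
  ℚᵘ.mkℚᵘ z 0 ℚᵘ.+ ℚᵘ.mkℚᵘ w 0         ≈⟨ ℚᵘ.+-cong (ι-toℚᵘ z) (ι-toℚᵘ w) ⟨
  ℚ.toℚᵘ (ι z) ℚᵘ.+ ℚ.toℚᵘ (ι w)       ≈⟨ ℚ.toℚᵘ-homo-+ (ι z) (ι w) ⟨
  ℚ.toℚᵘ (ι z ℚ.+ ι w)                 ∎)
  where open import Relation.Binary.Reasoning.Setoid ℚᵘ.≃-setoid

ι-* : ∀ z w → ι (z ℤ.* w) ≡ ι z ℚ.* ι w
ι-* z w = ℚ.toℚᵘ-injective (begin
  ℚ.toℚᵘ (ι (z ℤ.* w))                 ≈⟨ ι-toℚᵘ _ ⟩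
  ℚᵘ.mkℚᵘ z 0 ℚᵘ.* ℚᵘ.mkℚᵘ w 0         ≈⟨ ℚᵘ.*-cong (ι-toℚᵘ z) (ι-toℚᵘ w) ⟨
  ℚ.toℚᵘ (ι z) ℚᵘ.* ℚ.toℚᵘ (ι w)       ≈⟨ ℚ.toℚᵘ-homo-* (ι z) (ι w) ⟨
  ℚ.toℚᵘ (ι z ℚ.* ι w)                 ∎)
  where open import Relation.Binary.Reasoning.Setoid ℚᵘ.≃-setoid

ι-neg : ∀ z → ι (ℤ.- z) ≡ ℚ.- ι z
ι-neg z = ℚ.toℚᵘ-injective (begin
  ℚ.toℚᵘ (ι (ℤ.- z))      ≈⟨ ι-toℚᵘ _ ⟩
  ℚᵘ.- ℚᵘ.mkℚᵘ z 0        ≈⟨ ℚᵘ.-‿cong (ι-toℚᵘ z) ⟨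
  ℚᵘ.- ℚ.toℚᵘ (ι z)       ≈⟨ ℚ.toℚᵘ-homo‿- (ι z) ⟨
  ℚ.toℚᵘ (ℚ.- ι z)        ∎)
  where open import Relation.Binary.Reasoning.Setoid ℚᵘ.≃-setoid

ιℕ : ℕ → ℚ
ιℕ n = ι (ℤ.+ n)

ιℕ-mono : ∀ {m n} → m ℕ.≤ n → ιℕ m ℚ.≤ ιℕ n
ιℕ-mono m≤n = ι-mono (ℤ.+≤+ m≤n)

ιℕ-suc : ∀ n → ιℕ (suc n) ≡ ιℕ n ℚ.+ 1ℚ
ιℕ-suc n = trans (cong ιℕ (ℕ.+-comm 1 n)) (ι-suc (ℤ.+ n))

ιℕ-cancel-≤ : ∀ {m n} → ιℕ m ℚ.≤ ιℕ n → m ℕ.≤ n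
ιℕ-cancel-≤ {m} {n} m≤n = ℕ.≮⇒≥ λ n<m →
  <⇒≱ (ℚ.<-≤-trans (subst (ιℕ n ℚ.<_) (sym (ιℕ-suc n)) (q<q+1 (ιℕ n))) (ιℕ-mono n<m)) m≤n

ιℕ-* : ∀ m n → ιℕ (m ℕ.* n) ≡ ιℕ m ℚ.* ιℕ n
ιℕ-* m n = trans (cong ι (ℤ.pos-* m n)) (ι-* (ℤ.+ m) (ℤ.+ n))

0≤ιℕ : ∀ n → 0ℚ ℚ.≤ ιℕ n
0≤ιℕ n = ℚ.nonNegative⁻¹ (ιℕ n) {{ι-nonNeg n}}

*-monoˡ-≤ : ∀ {p q} r → 0ℚ ℚ.≤ r → p ℚ.≤ q → r ℚ.* p ℚ.≤ r ℚ.* q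
*-monoˡ-≤ r 0≤r = ℚ.*-monoˡ-≤-nonNeg r {{ℚ.nonNegative 0≤r}}

*-monoʳ-≤ : ∀ {p q} r → 0ℚ ℚ.≤ r → p ℚ.≤ q → p ℚ.* r ℚ.≤ q ℚ.* r
*-monoʳ-≤ r 0≤r = ℚ.*-monoʳ-≤-nonNeg r {{ℚ.nonNegative 0≤r}}

0≤* : ∀ {p q} → 0ℚ ℚ.≤ p → 0ℚ ℚ.≤ q → 0ℚ ℚ.≤ p ℚ.* q
0≤* {p} {q} 0≤p 0≤q = subst (ℚ._≤ p ℚ.* q) (ℚ.*-zeroʳ p) (*-monoˡ-≤ p 0≤p 0≤q)

*-mono-≤ : ∀ {p q r s} → 0ℚ ℚ.≤ p → 0ℚ ℚ.≤ s → p ℚ.≤ q → r ℚ.≤ s → p ℚ.* r ℚ.≤ q ℚ.* s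
*-mono-≤ {p} {s = s} 0≤p 0≤s p≤q r≤s = ℚ.≤-trans (*-monoˡ-≤ p 0≤p r≤s) (*-monoʳ-≤ s 0≤s p≤q)

0<-diff : ∀ {p q} → p ℚ.< q → 0ℚ ℚ.< q ℚ.- p
0<-diff {p} {q} p<q = subst (ℚ._< q ℚ.- p) (ℚ.+-inverseʳ p) (ℚ.+-monoˡ-< (ℚ.- p) p<q)

-- The power is formed in ℕ and then embedded, because `ν` scales by a natural number; `2^ t` is
-- defined through the rational power `2ℚ ^ n` instead.
pow : ℕ → ℚ
pow n = ιℕ (2 ℕ.^ n)

pow-pos : ∀ n → ℚ.Positive (pow n)
pow-pos n = ℚ.normalize-pos (2 ℕ.^ n) 1 {{_}} {{ℕ.m^n≢0 2 n}}

0<pow : ∀ n → 0ℚ ℚ.< pow n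
0<pow n = ℚ.positive⁻¹ (pow n) {{pow-pos n}}

0≤pow : ∀ n → 0ℚ ℚ.≤ pow n
0≤pow n = ℚ.<⇒≤ (0<pow n)

pow-+ : ∀ m n → pow (m ℕ.+ n) ≡ pow m ℚ.* pow n
pow-+ m n = trans (cong ιℕ (ℕ.^-distribˡ-+-* 2 m n)) (ιℕ-* (2 ℕ.^ m) (2 ℕ.^ n))

pow-suc : ∀ n → pow (suc n) ≡ 2ℚ ℚ.* pow n
pow-suc n = ιℕ-* 2 (2 ℕ.^ n)

pow-mono : ∀ {m n} → m ℕ.≤ n → pow m ℚ.≤ pow n
pow-mono m≤n = ιℕ-mono (ℕ.^-monoʳ-≤ 2 m≤n)

pow-cancel-< : ∀ {m n} → pow m ℚ.< pow n → m ℕ.< n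
pow-cancel-< {m} {n} lt = ℕ.≰⇒> λ n≤m → <⇒≱ lt (pow-mono n≤m)

n<2^n : ∀ n → n ℕ.< 2 ℕ.^ n
n<2^n zero    = ℕ.s≤s ℕ.z≤n
n<2^n (suc n) = begin-strict
  suc n              <⟨ ℕ.s≤s (n<2^n n) ⟩
  1 ℕ.+ 2 ℕ.^ n      ≤⟨ ℕ.+-mono-≤ (ℕ.m^n>0 2 n) (ℕ.≤-reflexive (sym (ℕ.+-identityʳ _))) ⟩
  2 ℕ.^ suc n        ∎
  where open ℕ.≤-Reasoning

archimedean : ∀ q → ∃ λ n → q ℚ.< ιℕ n
archimedean q = suc n , ℚ.≤-<-trans (above q)
  (subst (ιℕ n ℚ.<_) (sym (ιℕ-suc n)) (q<q+1 (ιℕ n)))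
  where n = ℤ.∣ ↥ q ∣

archimedean-* : ∀ e q → 0ℚ ℚ.< e → ∃ λ n → q ℚ.< ιℕ n ℚ.* e
archimedean-* e q 0<e = let n , lt = archimedean (q ℚ.* 1/e) in n , (begin-strict
  q                  ≡⟨ ℚ.*-identityʳ q ⟨
  q ℚ.* 1ℚ           ≡⟨ cong (q ℚ.*_) (ℚ.*-inverseˡ e) ⟨
  q ℚ.* (1/e ℚ.* e)  ≡⟨ ℚ.*-assoc q 1/e e ⟨
  q ℚ.* 1/e ℚ.* e    <⟨ ℚ.*-monoˡ-<-pos e lt ⟩
  ιℕ n ℚ.* e         ∎)
  where
  open ℚ.≤-Reasoning
  instance
    e-pos : ℚ.Positive e
    e-pos = ℚ.positive 0<e
    e-nonZero : ℚ.NonZero e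
    e-nonZero = ℚ.pos⇒nonZero e
  1/e = ℚ.1/ e

archimedean-pow : ∀ e q → 0ℚ ℚ.< e → ∃ λ n → q ℚ.< e ℚ.* pow n
archimedean-pow e q 0<e = let n , lt = archimedean-* e q 0<e in n , (begin-strict
  q            <⟨ lt ⟩
  ιℕ n ℚ.* e   ≤⟨ *-monoʳ-≤ e (ℚ.<⇒≤ 0<e) (ιℕ-mono (ℕ.<⇒≤ (n<2^n n))) ⟩
  pow n ℚ.* e  ≡⟨ ℚ.*-comm (pow n) e ⟩
  e ℚ.* pow n  ∎)
  where open ℚ.≤-Reasoning

-- Powers and approximate roots of rationals

^-mono-≤ : ∀ {p q} n → 0ℚ ℚ.≤ p → p ℚ.≤ q → p ^ n ℚ.≤ q ^ n
^-mono-≤ zero    _   _   = ℚ.≤-refl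
^-mono-≤ {p} {q} (suc n) 0≤p p≤q =
  *-mono-≤ 0≤p (^-nonNeg q n (ℚ.≤-trans 0≤p p≤q)) p≤q (^-mono-≤ n 0≤p p≤q)

^-mono-< : ∀ {p q} n .{{_ : NonZero n}} → 0ℚ ℚ.≤ p → p ℚ.< q → p ^ n ℚ.< q ^ n
^-mono-< {p} {q} (suc n) 0≤p p<q = begin-strict
  p ℚ.* p ^ n  ≤⟨ *-monoˡ-≤ p 0≤p (^-mono-≤ n 0≤p (ℚ.<⇒≤ p<q)) ⟩
  p ℚ.* q ^ n  <⟨ ℚ.*-monoˡ-<-pos (q ^ n) {{^-pos n}} p<q ⟩
  q ℚ.* q ^ n  ∎
  where
  open ℚ.≤-Reasoning
  q-pos : ℚ.Positive q
  q-pos = ℚ.positive (ℚ.≤-<-trans 0≤p p<q)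
  ^-pos : ∀ n → ℚ.Positive (q ^ n)
  ^-pos zero    = _
  ^-pos (suc n) = ℚ.pos*pos⇒pos q {{q-pos}} (q ^ n) {{^-pos n}}

^-cancel-< : ∀ {p q} n → 0ℚ ℚ.≤ q → p ^ n ℚ.< q ^ n → p ℚ.< q
^-cancel-< n 0≤q lt = ℚ.≰⇒> λ q≤p → <⇒≱ lt (^-mono-≤ n 0≤q q≤p)

^-cancel-≤ : ∀ {p q} n .{{_ : NonZero n}} → 0ℚ ℚ.≤ q → p ^ n ℚ.≤ q ^ n → p ℚ.≤ q
^-cancel-≤ n 0≤q le = ℚ.≮⇒≥ λ q<p → <⇒≱ (^-mono-< n 0≤q q<p) le

^-comm : ∀ p m n → (p ^ m) ^ n ≡ (p ^ n) ^ m
^-comm p m n = trans (^-assocʳ p m n) (trans (cong (p ^_) (ℕ.*-comm m n)) (sym (^-assocʳ p n m)))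

1^ : ∀ n → 1ℚ ^ n ≡ 1ℚ
1^ zero    = refl
1^ (suc n) = trans (ℚ.*-identityˡ _) (1^ n)

1≤^ : ∀ {p} n → 1ℚ ℚ.≤ p → 1ℚ ℚ.≤ p ^ n
1≤^ {p} n 1≤p = subst (ℚ._≤ p ^ n) (1^ n) (^-mono-≤ n (ℚ.nonNegative⁻¹ 1ℚ) 1≤p)

bernoulli : ∀ e n → 0ℚ ℚ.≤ e → 1ℚ ℚ.+ ιℕ n ℚ.* e ℚ.≤ (1ℚ ℚ.+ e) ^ n
bernoulli e zero    0≤e = ℚ.≤-reflexive (trans (cong (1ℚ ℚ.+_) (ℚ.*-zeroˡ e)) (ℚ.+-identityʳ 1ℚ))
bernoulli e (suc n) 0≤e = begin
  1ℚ ℚ.+ ιℕ (suc n) ℚ.* e                             ≡⟨ cong (λ x → 1ℚ ℚ.+ x ℚ.* e) (ιℕ-suc n) ⟩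
  1ℚ ℚ.+ (N ℚ.+ 1ℚ) ℚ.* e                             ≡⟨ ℚ.+-identityʳ _ ⟨
  1ℚ ℚ.+ (N ℚ.+ 1ℚ) ℚ.* e ℚ.+ 0ℚ                      ≤⟨ ℚ.+-monoʳ-≤ (1ℚ ℚ.+ (N ℚ.+ 1ℚ) ℚ.* e)
                                                           (0≤* (0≤* (0≤ιℕ n) 0≤e) 0≤e) ⟩
  1ℚ ℚ.+ (N ℚ.+ 1ℚ) ℚ.* e ℚ.+ N ℚ.* e ℚ.* e           ≡⟨ solve 2 (λ N e →
      con 1ℚ :+ (N :+ con 1ℚ) :* e :+ N :* e :* e := (con 1ℚ :+ e) :* (con 1ℚ :+ N :* e)) refl N e ⟩
  (1ℚ ℚ.+ e) ℚ.* (1ℚ ℚ.+ N ℚ.* e)                     ≤⟨ *-monoˡ-≤ (1ℚ ℚ.+ e)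
                                                           (ℚ.+-mono-≤ (ℚ.nonNegative⁻¹ 1ℚ) 0≤e) (bernoulli e n 0≤e) ⟩
  (1ℚ ℚ.+ e) ℚ.* (1ℚ ℚ.+ e) ^ n                       ∎
  where
  open ℚ.≤-Reasoning
  N = ιℕ n

-- By convexity `(1 + e)^n` lies below its chord between `e = 0` and `e = 1`; the induction step
-- bounds `e²` by `e`.
^-upper : ∀ e n → 0ℚ ℚ.≤ e → e ℚ.≤ 1ℚ → (1ℚ ℚ.+ e) ^ n ℚ.≤ 1ℚ ℚ.+ (2ℚ ^ n ℚ.- 1ℚ) ℚ.* e
^-upper e zero    0≤e e≤1 = ℚ.≤-reflexive (sym (trans (cong (1ℚ ℚ.+_) (ℚ.*-zeroˡ e)) (ℚ.+-identityʳ 1ℚ)))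
^-upper e (suc n) 0≤e e≤1 = begin
  (1ℚ ℚ.+ e) ℚ.* (1ℚ ℚ.+ e) ^ n                   ≤⟨ *-monoˡ-≤ (1ℚ ℚ.+ e)
                                                       (ℚ.+-mono-≤ (ℚ.nonNegative⁻¹ 1ℚ) 0≤e) (^-upper e n 0≤e e≤1) ⟩
  (1ℚ ℚ.+ e) ℚ.* (1ℚ ℚ.+ M ℚ.* e)                 ≡⟨ solve 2 (λ M e →
      (con 1ℚ :+ e) :* (con 1ℚ :+ M :* e) := con 1ℚ :+ e :+ M :* e :+ M :* e :* e) refl M e ⟩
  1ℚ ℚ.+ e ℚ.+ M ℚ.* e ℚ.+ M ℚ.* e ℚ.* e          ≤⟨ ℚ.+-monoʳ-≤ (1ℚ ℚ.+ e ℚ.+ M ℚ.* e)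
                                                       (*-monoˡ-≤ (M ℚ.* e) (0≤* 0≤M 0≤e) e≤1) ⟩
  1ℚ ℚ.+ e ℚ.+ M ℚ.* e ℚ.+ M ℚ.* e ℚ.* 1ℚ         ≡⟨ solve 2 (λ P e → let M = P :- con 1ℚ in
      con 1ℚ :+ e :+ M :* e :+ M :* e :* con 1ℚ := con 1ℚ :+ (con 2ℚ :* P :- con 1ℚ) :* e) refl (2ℚ ^ n) e ⟩
  1ℚ ℚ.+ (2ℚ ℚ.* 2ℚ ^ n ℚ.- 1ℚ) ℚ.* e             ∎
  where
  open ℚ.≤-Reasoning
  M = 2ℚ ^ n ℚ.- 1ℚ
  0≤M : 0ℚ ℚ.≤ M
  0≤M = subst (ℚ._≤ M) (ℚ.+-inverseʳ 1ℚ) (ℚ.+-monoˡ-≤ (ℚ.- 1ℚ) (1≤2^ n))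

½^*2^ : ∀ n → ½ ^ n ℚ.* 2ℚ ^ n ≡ 1ℚ
½^*2^ n = trans (sym (^-distrib-* ½ 2ℚ n)) (1^ n)

-- For `e = ½^n` the chord of `^-upper` has the value `1 + (2^n − 1)/2^n`, below 2. This supplies
-- the ratio of the geometric progression in `root`.
^≤2 : ∀ n → ∃ λ e → 0ℚ ℚ.< e × (1ℚ ℚ.+ e) ^ n ℚ.≤ 2ℚ
^≤2 n = e , 0<e n , (begin
  (1ℚ ℚ.+ e) ^ n                      ≤⟨ ^-upper e n (ℚ.<⇒≤ (0<e n)) (½^≤1 n) ⟩
  1ℚ ℚ.+ (2ℚ ^ n ℚ.- 1ℚ) ℚ.* e        ≡⟨ solve 2 (λ P e →
      con 1ℚ :+ (P :- con 1ℚ) :* e := con 1ℚ :+ e :* P :- e) refl (2ℚ ^ n) e ⟩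
  1ℚ ℚ.+ e ℚ.* 2ℚ ^ n ℚ.- e           ≤⟨ ℚ.+-monoʳ-≤ (1ℚ ℚ.+ e ℚ.* 2ℚ ^ n) (ℚ.neg-antimono-≤ (ℚ.<⇒≤ (0<e n))) ⟩
  1ℚ ℚ.+ e ℚ.* 2ℚ ^ n ℚ.- 0ℚ          ≡⟨ ℚ.+-identityʳ _ ⟩
  1ℚ ℚ.+ e ℚ.* 2ℚ ^ n                 ≡⟨ cong (1ℚ ℚ.+_) (½^*2^ n) ⟩
  2ℚ                                  ∎)
  where
  open ℚ.≤-Reasoning
  e = ½ ^ n
  0<e : ∀ n → 0ℚ ℚ.< ½ ^ n
  0<e zero    = ℚ.positive⁻¹ 1ℚ
  0<e (suc n) = subst (ℚ._< ½ ^ suc n) (ℚ.*-zeroʳ ½) (ℚ.*-monoʳ-<-pos ½ (0<e n))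

-- A discrete intermediate value argument. The search runs downward from the given `n`, so it finds
-- the last crossing before `n`, which need not be the least one.
first : ∀ {P : Pred ℕ 0ℓ} → (∀ n → Dec (P n)) → ¬ P 0 → ∀ n → P n → ∃ λ m → ¬ P m × P (suc m)
first P? ¬P0 zero    P0 = ⊥-elim (¬P0 P0)
first P? ¬P0 (suc n) Pn+1 with P? n
... | yes Pn = first P? ¬P0 n Pn
... | no ¬Pn = n , ¬Pn , Pn+1

-- A rational stand-in for an `l`-th root of a power of 2. If `y^l ≤ 2`, the `l`-th powers of
-- `1, y, y², …` grow by a factor of at most 2 per step, so they cannot jump over the interval from
-- `2^e` to `2^(e+1)`.
root : ∀ l .{{_ : NonZero l}} e → ∃ λ c → 0ℚ ℚ.≤ c × 2ℚ ^ e ℚ.< c ^ l × c ^ l ℚ.≤ 2ℚ ^ suc e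
root l@(suc l-1) e =
  let h , 0<h , y^l≤2 = ^≤2 l
      y = 1ℚ ℚ.+ h
      J , big = archimedean-* h (2ℚ ^ suc e) 0<h
      1≤y = subst (ℚ._≤ y) (ℚ.+-identityʳ 1ℚ) (ℚ.+-monoʳ-≤ 1ℚ (ℚ.<⇒≤ 0<h))
      0≤y^ = λ j → ^-nonNeg y j (ℚ.≤-trans (ℚ.nonNegative⁻¹ 1ℚ) 1≤y)
      J-big = begin-strict
        2ℚ ^ suc e                 <⟨ big ⟩
        ιℕ J ℚ.* h                 ≤⟨ subst (ℚ._≤ 1ℚ ℚ.+ ιℕ J ℚ.* h) (ℚ.+-identityˡ _)
                                        (ℚ.+-monoˡ-≤ (ιℕ J ℚ.* h) (ℚ.nonNegative⁻¹ 1ℚ)) ⟩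
        1ℚ ℚ.+ ιℕ J ℚ.* h          ≤⟨ bernoulli h J (ℚ.<⇒≤ 0<h) ⟩
        y ^ J                      ≡⟨ ℚ.*-identityʳ (y ^ J) ⟨
        y ^ J ℚ.* 1ℚ               ≤⟨ *-monoˡ-≤ (y ^ J) (0≤y^ J) (1≤^ l-1 (1≤^ J 1≤y)) ⟩
        (y ^ J) ^ l                ∎
      j , small , large = first (λ j → 2ℚ ^ suc e ℚ.<? (y ^ j) ^ l)
        (λ lt → <⇒≱ (subst (2ℚ ^ suc e ℚ.<_) (1^ l) lt) (1≤2^ (suc e))) J J-big
  in y ^ j , 0≤y^ j ,
     ℚ.*-cancelˡ-<-nonNeg 2ℚ (begin-strict
       2ℚ ℚ.* 2ℚ ^ e            <⟨ large ⟩
       (y ℚ.* y ^ j) ^ l        ≡⟨ ^-distrib-* y (y ^ j) l ⟩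
       y ^ l ℚ.* (y ^ j) ^ l    ≤⟨ *-monoʳ-≤ ((y ^ j) ^ l) (^-nonNeg (y ^ j) l (0≤y^ j)) y^l≤2 ⟩
       2ℚ ℚ.* (y ^ j) ^ l       ∎) ,
     ℚ.≮⇒≥ small
  where open ℚ.≤-Reasoning

-- Write `1/p = 1 + e`. Bernoulli's inequality makes `(1 + e)^(n+1)` at least 2 for large `n`, and
-- its product with `p^(n+1)` is 1.
^≤½ : ∀ p → 0ℚ ℚ.< p → p ℚ.< 1ℚ → ∃ λ n → p ^ suc n ℚ.≤ ½
^≤½ p 0<p p<1 =
  let n , lt = archimedean-* e 1ℚ 0<e in n , ℚ.*-cancelʳ-≤-pos 2ℚ (begin
    p ^ suc n ℚ.* 2ℚ                            ≤⟨ *-monoˡ-≤ (p ^ suc n) (^-nonNeg p (suc n) (ℚ.<⇒≤ 0<p)) (begin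
      2ℚ                        ≤⟨ ℚ.+-monoʳ-≤ 1ℚ (ℚ.<⇒≤ lt) ⟩
      1ℚ ℚ.+ ιℕ n ℚ.* e         ≤⟨ ℚ.+-monoʳ-≤ 1ℚ (*-monoʳ-≤ e (ℚ.<⇒≤ 0<e) (ιℕ-mono (ℕ.n≤1+n n))) ⟩
      1ℚ ℚ.+ ιℕ (suc n) ℚ.* e   ≤⟨ bernoulli e (suc n) (ℚ.<⇒≤ 0<e) ⟩
      (1ℚ ℚ.+ e) ^ suc n        ∎) ⟩
    p ^ suc n ℚ.* (1ℚ ℚ.+ e) ^ suc n            ≡⟨ ^-distrib-* p (1ℚ ℚ.+ e) (suc n) ⟨
    (p ℚ.* (1ℚ ℚ.+ e)) ^ suc n                  ≡⟨ cong (_^ suc n) (trans (cong (p ℚ.*_)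
        (solve 1 (λ i → con 1ℚ :+ (i :- con 1ℚ) := i) refl 1/p)) (ℚ.*-inverseʳ p)) ⟩
    1ℚ ^ suc n                                  ≡⟨ 1^ (suc n) ⟩
    1ℚ                                          ∎)
  where
  open ℚ.≤-Reasoning
  instance
    p-pos : ℚ.Positive p
    p-pos = ℚ.positive 0<p
    p-nonZero : ℚ.NonZero p
    p-nonZero = ℚ.pos⇒nonZero p
  1/p = ℚ.1/ p
  e = 1/p ℚ.- 1ℚ
  0<e : 0ℚ ℚ.< e
  0<e = 0<-diff (ℚ.*-cancelˡ-<-nonNeg p {{ℚ.pos⇒nonNeg p}}
    (subst (p ℚ.* 1ℚ ℚ.<_) (sym (ℚ.*-inverseʳ p)) (subst (ℚ._< 1ℚ) (sym (ℚ.*-identityʳ p)) p<1)))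

-- The function 2^

dense-below-1 : ∀ {r} → r ℚ.< 1ℚ → ∃ λ p → r ℚ.< p × 0ℚ ℚ.< p × p ℚ.< 1ℚ
dense-below-1 {r} r<1 with r ℚ.<? 0ℚ
... | yes r<0 = ½ , ℚ.<-trans r<0 (ℚ.positive⁻¹ ½) , ℚ.positive⁻¹ ½ , ℚ.*<* (ℤ.+<+ (ℕ.s≤s (ℕ.s≤s ℕ.z≤n)))
... | no r≮0 = let p , r<p , p<1 = ℚ.<-dense r<1 in p , r<p , ℚ.≤-<-trans (ℚ.≮⇒≥ r≮0) r<p , p<1

-- The witnessing exponent is `-1/(n+1)`, which is negative and hence below `t`; it admits `p`
-- because `p^(n+1) ≤ ½`.
1≤2^t : ∀ t {r} → r ℚ.< 1ℚ → r ∈ cut (2^ t)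
1≤2^t t r<1 =
  let p , r<p , 0<p , p<1 = dense-below-1 r<1
      n , p^n≤½ = ^≤½ p 0<p p<1
      q = ℚ.mkℚ -[1+ 0 ] n (1-coprimeTo (suc n))
  in p , r<p , ℚ.<⇒≤ 0<p , q , 0≤ t (ℚ.negative⁻¹ q) , p^n≤½

2^t≤2 : ∀ t {r} → r ∈ cut (2^ t) → r ℚ.< 2ℚ
2^t≤2 t {r} (p , r<p , _ , q@(ℚ.mkℚ _ d-1 _) , q∈t , le) = ℚ.<-≤-trans r<p (ℚ.≮⇒≥ λ 2<p →
  <⇒≱ (2^<^ 2<p d-1) (ℚ.≤-trans le (2^ℤ≤2^ (↥ q) (suc d-1) (<1⇒↥≤↧ q (≤1 t q∈t)))))

2^-mono-≤ : ∀ t t′ → val t ≤ val t′ → 2^ t ≤ 2^ t′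
2^-mono-≤ t t′ t≤t′ (p , r<p , 0≤p , q , q∈t , le) = p , r<p , 0≤p , q , t≤t′ q∈t , le

2^0≤1 : ∀ t → val t ≤ 0ℝ → ∀ {r} → r ∈ cut (2^ t) → r ℚ.< 1ℚ
2^0≤1 t t≤0 (p , r<p , 0≤p , q@(ℚ.mkℚ z d-1 _) , q∈t , le) = ℚ.<-≤-trans r<p
  (^-cancel-≤ (suc d-1) (ℚ.nonNegative⁻¹ 1ℚ) (ℚ.≤-trans le (subst (2^ℤ z ℚ.≤_) (sym (1^ (suc d-1)))
    (2^ℤ≤2^ z 0 z≤0))))
  where
  z≤0 : z ℤ.≤ ℤ.+ 0
  z≤0 = subst (ℤ._≤ ℤ.+ 0) (ℤ.*-identityʳ z) (ℚ.drop-*≤* (ℚ.<⇒≤ (t≤0 q∈t)))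

n-coprime-1+n : ∀ n → Coprime n (suc n)
n-coprime-1+n n = Coprimality.sym (subst (λ m → Coprime m n) (ℕ.+-comm n 1) (coprime-+ (1-coprimeTo n)))

-- The witnessing exponent is `n/(n+1) < 1`: from `p^(n+1) ≤ ½` follows `(2p)^(n+1) ≤ 2^n`.
2≤2^1 : ∀ t → 1ℝ ≤ val t → ∀ {r} → r ℚ.< 2ℚ → r ∈ cut (2^ t)
2≤2^1 t 1≤t {r} r<2 =
  let p , r½<p , 0<p , p<1 = dense-below-1 (ℚ.*-monoˡ-<-pos ½ r<2)
      n , p^n≤½ = ^≤½ p 0<p p<1
      q = ℚ.mkℚ (ℤ.+ n) n (n-coprime-1+n n)
      n<n+1 = ℚ.*<* (subst (ℤ._< ℤ.+ 1 ℤ.* ℤ.+ suc n) (sym (ℤ.*-identityʳ (ℤ.+ n)))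
                (subst (ℤ.+ n ℤ.<_) (sym (ℤ.*-identityˡ (ℤ.+ suc n))) (ℤ.+<+ ℕ.≤-refl)))
  in 2ℚ ℚ.* p ,
     (begin-strict
       r                   ≡⟨ solve 1 (λ r → r := con 2ℚ :* (r :* con ½)) refl r ⟩
       2ℚ ℚ.* (r ℚ.* ½)    <⟨ ℚ.*-monoʳ-<-pos 2ℚ r½<p ⟩
       2ℚ ℚ.* p            ∎) ,
     0≤* (ℚ.nonNegative⁻¹ 2ℚ) (ℚ.<⇒≤ 0<p) , q , 1≤t n<n+1 ,
     (begin
       (2ℚ ℚ.* p) ^ suc n            ≡⟨ ^-distrib-* 2ℚ p (suc n) ⟩
       2ℚ ^ suc n ℚ.* p ^ suc n      ≤⟨ *-monoˡ-≤ (2ℚ ^ suc n) (ℚ.≤-trans (ℚ.nonNegative⁻¹ 1ℚ) (1≤2^ (suc n))) p^n≤½ ⟩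
       2ℚ ^ suc n ℚ.* ½              ≡⟨ solve 1 (λ x → con 2ℚ :* x :* con ½ := x) refl (2ℚ ^ n) ⟩
       2ℚ ^ n                        ∎)
  where open ℚ.≤-Reasoning

-- Put the exponents `p = a/n` and `q = b/m` over the common denominator `L = 2mn`, so that
-- `p = A/L`. The factor 2 makes the numerators differ by at least 2, which leaves room for roots
-- with `2^A < c^L ≤ 2^(A+1) < d^L ≤ 2^(A+2)`.
2^-strict : ∀ t t′ {p} → p ∉ cut (val t) → p ∈ cut (val t′) → ∃ λ c → c ∉ cut (2^ t) × c ∈ cut (2^ t′)
2^-strict t t′ {p} p∉t p∈t′ =
  let q , p<q , q∈t′ = rounded (val t′) p∈t′
      0≤p = ℚ.≮⇒≥ λ p<0 → p∉t (0≤ t p<0)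
  in strict p q p∉t 0≤p (ℚ.≤-trans 0≤p (ℚ.<⇒≤ p<q)) p<q q∈t′
  where
  strict : ∀ p q → p ∉ cut (val t) → 0ℚ ℚ.≤ p → 0ℚ ℚ.≤ q → p ℚ.< q → q ∈ cut (val t′) →
           ∃ λ c → c ∉ cut (2^ t) × c ∈ cut (2^ t′)
  strict p@(ℚ.mkℚ -[1+ _ ] _ _) q _ 0≤p _ _ _ = ⊥-elim (<⇒≱ (ℚ.negative⁻¹ p) 0≤p)
  strict p q@(ℚ.mkℚ -[1+ _ ] _ _) _ _ 0≤q _ _ = ⊥-elim (<⇒≱ (ℚ.negative⁻¹ q) 0≤q)
  strict p@(ℚ.mkℚ (ℤ.+ a) n-1 _) q@(ℚ.mkℚ (ℤ.+ b) m-1 _) p∉t _ _ (ℚ.*<* am<bn) q∈t′ =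
    c , c∉ , d , c<d , 0≤d , q , q∈t′ , d^m≤2^b
    where
    open ℚ.≤-Reasoning
    n = suc n-1
    m = suc m-1
    L = m ℕ.* (2 ℕ.* n)
    A = a ℕ.* (2 ℕ.* m)
    rc = root L A
    c = proj₁ rc
    2^A<c^L = proj₁ (proj₂ (proj₂ rc))
    rd = root L (suc A)
    d = proj₁ rd
    0≤d = proj₁ (proj₂ rd)
    c<d : c ℚ.< d
    c<d = ^-cancel-< L 0≤d (ℚ.≤-<-trans (proj₂ (proj₂ (proj₂ rc))) (proj₁ (proj₂ (proj₂ rd))))

    am<bn′ : a ℕ.* m ℕ.< b ℕ.* n
    am<bn′ = ℤ.drop‿+<+ (subst (ℤ._< ℤ.+ (b ℕ.* n)) (sym (ℤ.pos-* a m))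
                          (subst (ℤ.+ a ℤ.* ℤ.+ m ℤ.<_) (sym (ℤ.pos-* b n)) am<bn))

    2+A≤ : suc (suc A) ℕ.≤ b ℕ.* (2 ℕ.* n)
    2+A≤ = ℕ.≤-trans (ℕ.≤-reflexive (ℕ-solve 2 (λ a m → ℕ-con 2 ℕ:+ a ℕ:* (ℕ-con 2 ℕ:* m)
                        ℕ:= ℕ-con 2 ℕ:* (ℕ-con 1 ℕ:+ a ℕ:* m)) refl a m))
             (ℕ.≤-trans (ℕ.*-monoʳ-≤ 2 am<bn′)
               (ℕ.≤-reflexive (ℕ-solve 2 (λ b n → ℕ-con 2 ℕ:* (b ℕ:* n)
                        ℕ:= b ℕ:* (ℕ-con 2 ℕ:* n)) refl b n)))

    d^m≤2^b : d ^ m ℚ.≤ 2ℚ ^ b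
    d^m≤2^b = ^-cancel-≤ (2 ℕ.* n) (^-nonNeg 2ℚ b (ℚ.nonNegative⁻¹ 2ℚ)) (begin
      (d ^ m) ^ (2 ℕ.* n)    ≡⟨ ^-assocʳ d m (2 ℕ.* n) ⟩
      d ^ L                  ≤⟨ proj₂ (proj₂ (proj₂ rd)) ⟩
      2ℚ ^ suc (suc A)       ≤⟨ 2^-mono 2+A≤ ⟩
      2ℚ ^ (b ℕ.* (2 ℕ.* n)) ≡⟨ ^-assocʳ 2ℚ b (2 ℕ.* n) ⟨
      (2ℚ ^ b) ^ (2 ℕ.* n)   ∎)

    exponent : ∀ z k-1 → z ℤ.* ℤ.+ n ℤ.< ℤ.+ a ℤ.* ℤ.+ suc k-1 →
               ∃ λ a₀ → 2^ℤ z ℚ.≤ 2ℚ ^ a₀ × a₀ ℕ.* n ℕ.≤ a ℕ.* suc k-1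
    -- A negative numerator is replaced by 0, since only an upper bound for `2^ℤ z` is wanted.
    exponent -[1+ i ]  k-1 _  = 0 , 2^ℤ≤2^ -[1+ i ] 0 ℤ.-≤+ , ℕ.z≤n
    exponent (ℤ.+ a₀)  k-1 lt = a₀ , ℚ.≤-refl , ℕ.<⇒≤ (ℤ.drop‿+<+
      (subst (ℤ._< ℤ.+ (a ℕ.* suc k-1)) (sym (ℤ.pos-* a₀ n))
        (subst (ℤ.+ a₀ ℤ.* ℤ.+ n ℤ.<_) (sym (ℤ.pos-* a (suc k-1))) lt)))

    c∉ : c ∉ cut (2^ t)
    c∉ (r , c<r , 0≤r , q₀@(ℚ.mkℚ z k-1 _) , q₀∈t , r^k≤2^z) =
      let a₀ , 2^z≤2^a₀ , a₀n≤ak = exponent z k-1 (ℚ.drop-*<* (∉-above (val t) q₀∈t p∉t))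
          k = suc k-1
      in ℚ.<-irrefl refl (begin-strict
        (2ℚ ^ A) ^ k                  <⟨ ^-mono-< k (^-nonNeg 2ℚ A (ℚ.nonNegative⁻¹ 2ℚ)) 2^A<c^L ⟩
        (c ^ L) ^ k                   ≡⟨ ^-comm c L k ⟩
        (c ^ k) ^ L                   ≤⟨ ^-mono-≤ L (^-nonNeg c k (proj₁ (proj₂ rc)))
                                           (^-mono-≤ k (proj₁ (proj₂ rc)) (ℚ.<⇒≤ c<r)) ⟩
        (r ^ k) ^ L                   ≤⟨ ^-mono-≤ L (^-nonNeg r k 0≤r) (ℚ.≤-trans r^k≤2^z 2^z≤2^a₀) ⟩
        (2ℚ ^ a₀) ^ L                 ≡⟨ ^-assocʳ 2ℚ a₀ L ⟩
        2ℚ ^ (a₀ ℕ.* L)               ≤⟨ 2^-mono (ℕ.≤-trans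
            (ℕ.≤-reflexive (ℕ-solve 3 (λ a₀ m n → a₀ ℕ:* (m ℕ:* (ℕ-con 2 ℕ:* n))
               ℕ:= ℕ-con 2 ℕ:* m ℕ:* (a₀ ℕ:* n)) refl a₀ m n))
            (ℕ.≤-trans (ℕ.*-monoʳ-≤ (2 ℕ.* m) a₀n≤ak)
              (ℕ.≤-reflexive (ℕ-solve 3 (λ a m k → ℕ-con 2 ℕ:* m ℕ:* (a ℕ:* k)
                 ℕ:= a ℕ:* (ℕ-con 2 ℕ:* m) ℕ:* k) refl a m k)))) ⟩
        2ℚ ^ (A ℕ.* k)                ≡⟨ ^-assocʳ 2ℚ A k ⟨
        (2ℚ ^ A) ^ k                  ∎)

-- Counting and ν

·-∈ : ∀ x n {a} → a ∈ cut x → a ℚ.* pow n ∈ cut (x · 2 ℕ.^ n)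
·-∈ x n a∈x = let b , a<b , b∈x = rounded x a∈x in
  b ℚ.* pow n , ℚ.*-monoˡ-<-pos (pow n) {{pow-pos n}} a<b , b , b∈x , refl

·-∉ : ∀ x n {u} → u ∉ cut x → u ℚ.* pow n ∉ cut (x · 2 ℕ.^ n)
·-∉ x n u∉x (_ , lt , a , a∈x , refl) =
  u∉x (lower x (ℚ.*-cancelʳ-<-nonNeg (pow n) {{ι-nonNeg (2 ℕ.^ n)}} lt) a∈x)

·-≤ : ∀ x n y → (∀ {a} → a ∈ cut x → a ℚ.* pow n ∈ cut y) → x · 2 ℕ.^ n ≤ y
·-≤ x n y f (_ , q<p , a , a∈x , refl) = lower y q<p (f a∈x)

-- The members of τ^(-k) ω are the sets whose translate by k is in ω.
_⊕_ : 𝒫 → ℕ → 𝒫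
(A ⊕ k) m = ∃ λ n → n ∈ A × proj₁ n ℕ.+ k ≡ proj₁ m

module _ (em : ExcludedMiddle 0ℓ) where

  ⌊_⌋ : ℝ → ℕ
  ⌊ x ⌋ = ℤ.∣ floor em x ∣

  +⌊_⌋ : ∀ x → 0ℝ < x → ℤ.+ ⌊ x ⌋ ≡ floor em x
  +⌊ x ⌋ 0<x = ℤ.0≤i⇒+∣i∣≡i (proj₂ (proj₂ (floor-exists em x)) (ℤ.+ 0)
    λ q<0 → lower x q<0 (0<⇒0∈ x 0<x))

  ⌊⌋-lower : ∀ x → 0ℝ < x → ∀ {u} → u ∉ cut x → ιℕ ⌊ x ⌋ ℚ.≤ u
  ⌊⌋-lower x 0<x {u} u∉x = subst (ℚ._≤ u) (sym (cong ι (+⌊ x ⌋ 0<x)))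
    (ℚ.≮⇒≥ λ u<z → u∉x (proj₁ (proj₂ (floor-exists em x)) u<z))

  ⌊⌋-upper : ∀ x → 0ℝ < x → ∀ {q} → q ∈ cut x → q ℚ.≤ ιℕ ⌊ x ⌋ ℚ.+ 1ℚ
  ⌊⌋-upper x 0<x {q} q∈x = subst (λ y → q ℚ.≤ y ℚ.+ 1ℚ) (sym (cong ι (+⌊ x ⌋ 0<x)))
    (subst (q ℚ.≤_) (ι-suc z) (ℚ.≮⇒≥ λ z+1<q → ℤ.<-irrefl refl (ℤ.suc[i]≤j⇒i<j
      (subst (ℤ._≤ z) (ℤ.+-comm z (ℤ.+ 1)) (proj₂ (proj₂ (floor-exists em x)) (z ℤ.+ ℤ.+ 1)
        λ p<z+1 → lower x (ℚ.<-trans p<z+1 z+1<q) q∈x)))))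
    where z = floor em x

  count-suc : ∀ A k → count em A (suc k) ≡ count em A k ℕ.+ length (filter (λ n → em {n ∈ A}) (1+ k ∷ []))
  count-suc A k = begin
    length (filter A? (applyUpTo 1+_ (suc k)))                     ≡⟨ cong (λ l → length (filter A? l)) (applyUpTo-∷ʳ 1+_ k) ⟨
    length (filter A? (applyUpTo 1+_ k ∷ʳ 1+ k))                   ≡⟨ cong length (filter-++ A? (applyUpTo 1+_ k) (1+ k ∷ [])) ⟩
    length (filter A? (applyUpTo 1+_ k) ++ filter A? (1+ k ∷ []))  ≡⟨ length-++ (filter A? (applyUpTo 1+_ k)) ⟩
    count em A k ℕ.+ length (filter A? (1+ k ∷ []))                ∎
    where
    open ≡-Reasoning
    A? = λ n → em {n ∈ A}

  count-∈ : ∀ A k → 1+ k ∈ A → count em A (suc k) ≡ suc (count em A k)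
  count-∈ A k k+1∈A = trans (count-suc A k) (trans
    (cong (λ l → count em A k ℕ.+ length l) (filter-accept (λ n → em {n ∈ A}) k+1∈A)) (ℕ.+-comm (count em A k) 1))

  count-∉ : ∀ A k → 1+ k ∉ A → count em A (suc k) ≡ count em A k
  count-∉ A k k+1∉A = trans (count-suc A k) (trans
    (cong (λ l → count em A k ℕ.+ length l) (filter-reject (λ n → em {n ∈ A}) k+1∉A)) (ℕ.+-identityʳ (count em A k)))

  count-≤-suc : ∀ A k → count em A k ℕ.≤ count em A (suc k)
  count-≤-suc A k with em {1+ k ∈ A}
  ... | yes k∈ = ℕ.≤-trans (ℕ.n≤1+n _) (ℕ.≤-reflexive (sym (count-∈ A k k∈)))
  ... | no  k∉ = ℕ.≤-reflexive (sym (count-∉ A k k∉))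

  count-mono : ∀ A {j k} → j ℕ.≤ k → count em A j ℕ.≤ count em A k
  count-mono A j≤k = go (ℕ.≤⇒≤′ j≤k)
    where
    go : ∀ {j k} → j ℕ.≤′ k → count em A j ℕ.≤ count em A k
    go (ℕ.≤′-reflexive refl) = ℕ.≤-refl
    go (ℕ.≤′-step j≤k)       = ℕ.≤-trans (go j≤k) (count-≤-suc A _)

  count-≤ : ∀ A h k → (∀ n → 1+ n ∈ A → n ℕ.< k → n ℕ.< h) → count em A k ℕ.≤ h
  count-≤ A h zero    _ = ℕ.z≤n
  count-≤ A h (suc k) f with em {1+ k ∈ A}
  ... | no  k∉ = subst (ℕ._≤ h) (sym (count-∉ A k k∉)) (count-≤ A h k λ n n∈ n<k → f n n∈ (ℕ.m<n⇒m<1+n n<k))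
  -- Here `f` gives `k < h`, so the trivial bound of the count by `k`, which is the case `h = k`,
  -- suffices.
  ... | yes k∈ = ℕ.≤-trans (ℕ.≤-reflexive (count-∈ A k k∈))
        (ℕ.≤-trans (ℕ.s≤s (count-≤ A k k λ _ _ n<k → n<k)) (f k k∈ ℕ.≤-refl))

  -- For k > D the first alternative can fail, since A need not meet (D,∞).
  count-≥ : ∀ A C D → 0ℚ ℚ.≤ C → (∀ n → C ℚ.< ιℕ (suc n) → ιℕ (suc n) ℚ.≤ D → 1+ n ∈ A) → ∀ k →
            ιℕ k ℚ.≤ C ℚ.+ ιℕ (count em A k) ⊎ D ℚ.≤ C ℚ.+ ιℕ (count em A k) ℚ.+ 1ℚ
  count-≥ A C D 0≤C f zero = inj₁ (subst (0ℚ ℚ.≤_) (sym (ℚ.+-identityʳ C)) 0≤C)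
  count-≥ A C D 0≤C f (suc k) = step (count-≥ A C D 0≤C f k)
    where
    open ℚ.≤-Reasoning
    #k = count em A k
    #k+1 = count em A (suc k)

    step≤ : C ℚ.+ ιℕ #k ℚ.≤ C ℚ.+ ιℕ #k+1
    step≤ = ℚ.+-monoʳ-≤ C (ιℕ-mono (count-≤-suc A k))

    k+1≤ : ιℕ k ℚ.≤ C ℚ.+ ιℕ #k → ιℕ (suc k) ℚ.≤ C ℚ.+ ιℕ #k ℚ.+ 1ℚ
    k+1≤ k≤ = subst (ℚ._≤ C ℚ.+ ιℕ #k ℚ.+ 1ℚ) (sym (ιℕ-suc k)) (ℚ.+-monoˡ-≤ 1ℚ k≤)

    step′ : ιℕ k ℚ.≤ C ℚ.+ ιℕ #k → Dec (ιℕ (suc k) ℚ.≤ D) → Dec (C ℚ.< ιℕ (suc k)) →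
            ιℕ (suc k) ℚ.≤ C ℚ.+ ιℕ #k+1 ⊎ D ℚ.≤ C ℚ.+ ιℕ #k+1 ℚ.+ 1ℚ
    step′ k≤ (no k+1≰D) _ = inj₂ (ℚ.≤-trans (ℚ.<⇒≤ (ℚ.≰⇒> k+1≰D))
      (ℚ.≤-trans (k+1≤ k≤) (ℚ.+-monoˡ-≤ 1ℚ step≤)))
    step′ k≤ (yes _) (no C≮k+1) = inj₁ (ℚ.≤-trans (ℚ.≮⇒≥ C≮k+1)
      (subst (ℚ._≤ C ℚ.+ ιℕ #k+1) (ℚ.+-identityʳ C) (ℚ.+-monoʳ-≤ C (0≤ιℕ #k+1))))
    step′ k≤ (yes k+1≤D) (yes C<k+1) = inj₁ (begin
      ιℕ (suc k)               ≤⟨ k+1≤ k≤ ⟩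
      C ℚ.+ ιℕ #k ℚ.+ 1ℚ       ≡⟨ ℚ.+-assoc C (ιℕ #k) 1ℚ ⟩
      C ℚ.+ (ιℕ #k ℚ.+ 1ℚ)     ≡⟨ cong (C ℚ.+_) (ιℕ-suc #k) ⟨
      C ℚ.+ ιℕ (suc #k)        ≡⟨ cong (λ c → C ℚ.+ ιℕ c) (count-∈ A k (f k C<k+1 k+1≤D)) ⟨
      C ℚ.+ ιℕ #k+1            ∎)

    step : ιℕ k ℚ.≤ C ℚ.+ ιℕ #k ⊎ D ℚ.≤ C ℚ.+ ιℕ #k ℚ.+ 1ℚ →
           ιℕ (suc k) ℚ.≤ C ℚ.+ ιℕ #k+1 ⊎ D ℚ.≤ C ℚ.+ ιℕ #k+1 ℚ.+ 1ℚ
    step (inj₂ D≤) = inj₂ (ℚ.≤-trans D≤ (ℚ.+-monoˡ-≤ 1ℚ step≤))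
    step (inj₁ k≤) = step′ k≤ (ιℕ (suc k) ℚ.≤? D) (C ℚ.<? ιℕ (suc k))

module _ (em em′ : ExcludedMiddle 0ℓ) where

  ⌊⌋-mono : ∀ x y → 0ℝ < x → 0ℝ < y → x ≤ y → ⌊_⌋ em x ℕ.≤ ⌊_⌋ em′ y
  ⌊⌋-mono x y 0<x 0<y x≤y = ℤ.drop‿+≤+ (begin
    ℤ.+ ⌊_⌋ em x     ≡⟨ +⌊_⌋ em x 0<x ⟩
    floor em x       ≤⟨ proj₂ (proj₂ (floor-exists em′ y)) (floor em x)
                          (λ q<z → x≤y (proj₁ (proj₂ (floor-exists em x)) q<z)) ⟩
    floor em′ y      ≡⟨ +⌊_⌋ em′ y 0<y ⟨
    ℤ.+ ⌊_⌋ em′ y    ∎)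
    where open ℤ.≤-Reasoning

  -- Each point of `Ω*` counts with the excluded middle supplied by its own ultrafilter, so the
  -- counts at two points must first be identified.
  count-em : ∀ A k → count em A k ≡ count em′ A k
  count-em A zero    = refl
  count-em A (suc k) with em {1+ k ∈ A}
  ... | yes k∈ = trans (count-∈ em A k k∈) (trans (cong suc (count-em A k)) (sym (count-∈ em′ A k k∈)))
  ... | no  k∉ = trans (count-∉ em A k k∉) (trans (count-em A k) (sym (count-∉ em′ A k k∉)))

-- Densities, and `ν` under translation of the ultrafilter

Density : ExcludedMiddle 0ℓ → 𝒫 → ℝ → Pred ℚ 0ℓ
Density em A x q = ∃ λ p → q ℚ.< p × ∃ λ u → u ∉ cut x × p ℚ.* u ℚ.≤ ιℕ (count em A (⌊_⌋ em x))

scale : Ω* → ℕ⁺ → ℝ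
scale (ω , t) n = 2^ t · 2 ℕ.^ proj₁ n

-- `lim-exists` takes the supremum of the rationals below ω-most terms, and `Density` is the cut of
-- `density`; so this and the converse are the identity.
ν-∈ : ∀ η A {q} → (∃ λ p → q ℚ.< p × (λ n → p ∈ Density (decide (proj₁ η)) A (scale η n)) ∈ sets (proj₁ η)) →
      q ∈ cut (ν η A)
ν-∈ η A x = x

ν-∈⁻ : ∀ η A {q} → q ∈ cut (ν η A) →
       ∃ λ p → q ℚ.< p × (λ n → p ∈ Density (decide (proj₁ η)) A (scale η n)) ∈ sets (proj₁ η)
ν-∈⁻ η A x = x

Density-≃ : ∀ (em em′ : ExcludedMiddle 0ℓ) A x y → 0ℝ < x → 0ℝ < y → x ≃ y → Density em A x ⊆ Density em′ A y
Density-≃ em em′ A x y 0<x 0<y (x≤y , y≤x) (p , q<p , u , u∉x , le) =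
  p , q<p , u , (λ u∈y → u∉x (y≤x u∈y)) , ℚ.≤-trans le (ιℕ-mono
    (ℕ.≤-trans (ℕ.≤-reflexive (count-em em em′ A (⌊_⌋ em x))) (count-mono em′ A (⌊⌋-mono em em′ x y 0<x 0<y x≤y))))

0<scale : ∀ η n → 0ℝ < scale η n
0<scale (ω , t) n = ·-positive (2^ t) (2 ℕ.^ proj₁ n) {{ℕ.m^n≢0 2 (proj₁ n)}} (2^-positive t)

1/pow : ℕ → ℚ
1/pow n = (ℚ.1/ pow n) {{ℚ.pos⇒nonZero (pow n) {{pow-pos n}}}}

1/pow*pow : ∀ n → 1/pow n ℚ.* pow n ≡ 1ℚ
1/pow*pow n = ℚ.*-inverseˡ (pow n) {{ℚ.pos⇒nonZero (pow n) {{pow-pos n}}}}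

0<1/pow : ∀ n → 0ℚ ℚ.< 1/pow n
0<1/pow n = ℚ.positive⁻¹ (1/pow n) {{ℚ.1/pos⇒pos (pow n) {{pow-pos n}}}}

<pow⇒∈scale : ∀ η n {u} → u ℚ.< pow (proj₁ n) → u ∈ cut (scale η n)
<pow⇒∈scale (ω , t) (n , _) {u} u<pow = subst (_∈ cut (2^ t · 2 ℕ.^ n)) u*1
  (·-∈ (2^ t) n (1≤2^t t (ℚ.*-cancelʳ-<-nonNeg (pow n) {{ι-nonNeg (2 ℕ.^ n)}} {u ℚ.* 1/pow n} {1ℚ} (begin-strict
    u ℚ.* 1/pow n ℚ.* pow n  ≡⟨ u*1 ⟩
    u                        <⟨ u<pow ⟩
    pow n                    ≡⟨ ℚ.*-identityˡ (pow n) ⟨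
    1ℚ ℚ.* pow n             ∎))))
  where
  open ℚ.≤-Reasoning
  u*1 : u ℚ.* 1/pow n ℚ.* pow n ≡ u
  u*1 = trans (ℚ.*-assoc u _ _) (trans (cong (u ℚ.*_) (1/pow*pow n)) (ℚ.*-identityʳ u))

pow≤scale : ∀ η n {u} → u ∉ cut (scale η n) → pow (proj₁ n) ℚ.≤ u
pow≤scale η n u∉ = ℚ.≮⇒≥ λ u<pow → u∉ (<pow⇒∈scale η n u<pow)

2∉2^ : ∀ t → 2ℚ ∉ cut (2^ t)
2∉2^ t 2∈ = ℚ.<-irrefl refl (2^t≤2 t 2∈)

-- For `n = m + k` the count up to `scale η′ m` is at most the count up to `scale η n`, while the
-- denominators satisfy `scale η n ≤ 2 · 2^n = 2^(k+1) · 2^m ≤ 2^(k+1) · scale η′ m`. Hence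
-- densities shrink at most by the factor `2^(k+1)`.
ν-shift : ∀ η η′ k →
          (∀ (A : 𝒫) → A ∈ sets (proj₁ η′) → (A ⊕ k) ∈ sets (proj₁ η)) →
          (∀ m n → proj₁ m ℕ.+ k ≡ proj₁ n → scale η′ m ≤ scale η n) →
          ∀ A {q} → q ∈ cut (ν η′ A) → q ℚ.* 1/pow (suc k) ∈ cut (ν η A)
ν-shift η@(ω , t) η′ k shift scale≤ A {q} q∈ν′ = scaled-∈ (ν-∈⁻ η′ A q∈ν′)
  where
  em = decide ω
  em′ = decide (proj₁ η′)
  g = 1/pow (suc k)

  scaled : ∀ {q p} → q ℚ.< p → q ℚ.* g ℚ.< p ℚ.* g
  scaled = ℚ.*-monoˡ-<-pos g {{ℚ.positive (0<1/pow (suc k))}}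

  r*pow≤ : ∀ r m u (c : ℕ) → u ∉ cut (scale η′ m) → r ℚ.* u ℚ.≤ ιℕ c → Dec (0ℚ ℚ.≤ r) → r ℚ.* pow (proj₁ m) ℚ.≤ ιℕ c
  r*pow≤ r m u c u∉ ru≤ (yes 0≤r) = ℚ.≤-trans (*-monoˡ-≤ r 0≤r (pow≤scale η′ m u∉)) ru≤
  -- A negative `r` would reverse `pow≤scale`, but then the left side is at most 0.
  r*pow≤ r (m , _) u c u∉ ru≤ (no 0≰r) = begin
    r ℚ.* pow m     ≤⟨ *-monoʳ-≤ (pow m) (0≤pow m) (ℚ.<⇒≤ (ℚ.≰⇒> 0≰r)) ⟩
    0ℚ ℚ.* pow m    ≡⟨ ℚ.*-zeroˡ (pow m) ⟩
    0ℚ              ≤⟨ 0≤ιℕ c ⟩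
    ιℕ c            ∎
    where open ℚ.≤-Reasoning

  rescale : ∀ r m → r ℚ.* g ℚ.* (2ℚ ℚ.* pow (m ℕ.+ k)) ≡ r ℚ.* pow m
  rescale r m = begin
    r ℚ.* g ℚ.* (2ℚ ℚ.* pow (m ℕ.+ k))          ≡⟨ cong (λ x → r ℚ.* g ℚ.* (2ℚ ℚ.* x)) (pow-+ m k) ⟩
    r ℚ.* g ℚ.* (2ℚ ℚ.* (pow m ℚ.* pow k))      ≡⟨ solve 4 (λ r g a b →
        r :* g :* (con 2ℚ :* (a :* b)) := r :* a :* (g :* (con 2ℚ :* b))) refl r g (pow m) (pow k) ⟩
    r ℚ.* pow m ℚ.* (g ℚ.* (2ℚ ℚ.* pow k))      ≡⟨ cong (λ x → r ℚ.* pow m ℚ.* (g ℚ.* x)) (pow-suc k) ⟨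
    r ℚ.* pow m ℚ.* (g ℚ.* pow (suc k))         ≡⟨ cong (r ℚ.* pow m ℚ.*_) (1/pow*pow (suc k)) ⟩
    r ℚ.* pow m ℚ.* 1ℚ                          ≡⟨ ℚ.*-identityʳ (r ℚ.* pow m) ⟩
    r ℚ.* pow m                                 ∎
    where open ≡-Reasoning

  count≤ : ∀ m n → proj₁ m ℕ.+ k ≡ proj₁ n →
           count em′ A (⌊_⌋ em′ (scale η′ m)) ℕ.≤ count em A (⌊_⌋ em (scale η n))
  count≤ m n eq = ℕ.≤-trans (ℕ.≤-reflexive (count-em em′ em A (⌊_⌋ em′ (scale η′ m))))
    (count-mono em A (⌊⌋-mono em′ em (scale η′ m) (scale η n) (0<scale η′ m) (0<scale η n) (scale≤ m n eq)))

  bound : ∀ {p} m n → proj₁ m ℕ.+ k ≡ proj₁ n → p ∈ Density em′ A (scale η′ m) → p ℚ.* g ∈ Density em A (scale η n)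
  bound m n refl (r , p<r , u , u∉ , ru≤) =
    -- As `2^ t` never exceeds 2, `2 · 2^n` is an upper bound of `scale η n` for every `t`; this
    -- accounts for the exponent `suc k` in place of `k`.
    r ℚ.* g , scaled p<r , 2ℚ ℚ.* pow (proj₁ n) , ·-∉ (2^ t) (proj₁ n) (2∉2^ t) ,
    ℚ.≤-trans (ℚ.≤-reflexive (rescale r (proj₁ m)))
      (ℚ.≤-trans (r*pow≤ r m u (count em′ A (⌊_⌋ em′ (scale η′ m))) u∉ ru≤ (0ℚ ℚ.≤? r)) (ιℕ-mono (count≤ m n refl)))

  scaled-∈ : (∃ λ p → q ℚ.< p × (λ n → p ∈ Density em′ A (scale η′ n)) ∈ sets (proj₁ η′)) → q ℚ.* g ∈ cut (ν η A)
  scaled-∈ (p , q<p , p∈) = ν-∈ η A (p ℚ.* g , scaled q<p ,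
    upward ω {(λ m → p ∈ Density em′ A (scale η′ m)) ⊕ k} {λ n → p ℚ.* g ∈ Density em A (scale η n)}
      (λ { {n} (m , d , eq) → bound m n eq d }) (shift (λ m → p ∈ Density em′ A (scale η′ m)) p∈))

-- For a rational `e` strictly between 0 and `ϵ` take `δ = e · g`: if `ν₁ A` exceeded `e`, then
-- `ν₂ A` would exceed `δ`.
≪-scaled : ∀ {ν₁ ν₂ : 𝒫 → ℝ} g → 0ℚ ℚ.< g → (∀ A {q} → q ∈ cut (ν₁ A) → q ℚ.* g ∈ cut (ν₂ A)) → ν₁ ≪ ν₂
≪-scaled {ν₁} {ν₂} g 0<g f ϵ 0<ϵ with 0<⇒positive ϵ 0<ϵ
... | e , e-pos , e∈ϵ = fromℚ (e ℚ.* g) ,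
  (0ℚ , ℚ.<-irrefl refl , ℚ.positive⁻¹ (e ℚ.* g) {{ℚ.pos*pos⇒pos e {{e-pos}} g {{ℚ.positive 0<g}}}}) ,
  λ { A (q , q∉ , q<eg) → e , (λ e∈ → q∉ (lower (ν₂ A) q<eg (f A e∈))) , e∈ϵ }

-- Invariance of `ν` under the gluing

·-mono : ∀ x y n → x ≤ y → x · 2 ℕ.^ n ≤ y · 2 ℕ.^ n
·-mono x y n x≤y = ·-≤ x n (y · 2 ℕ.^ n) λ a∈x → ·-∈ y n (x≤y a∈x)

scale-glue : ∀ {ω t t′} → val t ≃ 1ℝ → val t′ ≃ 0ℝ → ∀ n → scale (ω , t) n ≃ scale (τ ω , t′) (suc⁺ n)
scale-glue {ω} {t} {t′} (t≤1 , 1≤t) (t′≤0 , _) n@(n₀ , _) =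
  ·-≤ (2^ t) n₀ (2^ t′ · 2 ℕ.^ suc n₀) (λ {a} a∈ → subst (_∈ cut (2^ t′ · 2 ℕ.^ suc n₀))
    (trans (cong (a ℚ.* ½ ℚ.*_) (pow-suc n₀))
      (solve 2 (λ a b → a :* con ½ :* (con 2ℚ :* b) := a :* b) refl a (pow n₀)))
    (·-∈ (2^ t′) (suc n₀) (1≤2^t t′ (ℚ.*-monoˡ-<-pos ½ (2^t≤2 t a∈))))) ,
  ·-≤ (2^ t′) (suc n₀) (2^ t · 2 ℕ.^ n₀) (λ {b} b∈ → subst (_∈ cut (2^ t · 2 ℕ.^ n₀))
    (trans (solve 2 (λ b c → con 2ℚ :* b :* c := b :* (con 2ℚ :* c)) refl b (pow n₀))
      (cong (b ℚ.*_) (sym (pow-suc n₀))))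
    (·-∈ (2^ t) n₀ (2≤2^1 t 1≤t (ℚ.*-monoʳ-<-pos 2ℚ (2^0≤1 t′ t′≤0 b∈)))))

≃-sym : ∀ {x y} → x ≃ y → y ≃ x
≃-sym (x≤y , y≤x) = y≤x , x≤y

ν-≃ : ∀ {η η′} → Glue η η′ → ∀ A → ν η A ≃ ν η′ A
ν-≃ {η@(ω , t)} {η′@(ω′ , t′)} (same (ω⊆ω′ , ω′⊆ω) (t≤t′ , t′≤t)) A =
  (λ { (p , q<p , S) → p , q<p , upward ω′ (λ {n} → Density-≃ (decide ω) (decide ω′) A (scale η n) (scale η′ n)
      (0<scale η n) (0<scale η′ n) (scale≃ n)) (ω⊆ω′ S) }) ,
  (λ { (p , q<p , S) → p , q<p , upward ω (λ {n} → Density-≃ (decide ω′) (decide ω) A (scale η′ n) (scale η n)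
      (0<scale η′ n) (0<scale η n) (≃-sym {scale η n} {scale η′ n} (scale≃ n))) (ω′⊆ω S) })
  where
  scale≃ : ∀ n → scale η n ≃ scale η′ n
  scale≃ (n , _) = ·-mono (2^ t) (2^ t′) n (2^-mono-≤ t t′ t≤t′) , ·-mono (2^ t′) (2^ t) n (2^-mono-≤ t′ t t′≤t)
ν-≃ {η@(ω , t)} {η′@(_ , t′)} (glue t≃1 t′≃0) A =
  (λ { (p , q<p , S) → p , q<p , upward ω (λ {n} → Density-≃ (decide ω) (decide (τ ω)) A (scale η n) (scale η′ (suc⁺ n))
      (0<scale η n) (0<scale η′ (suc⁺ n)) (scale-glue {ω} {t} {t′} t≃1 t′≃0 n)) S }) ,
  (λ { (p , q<p , S) → p , q<p , upward ω (λ {n} → Density-≃ (decide (τ ω)) (decide ω) A (scale η′ (suc⁺ n)) (scale η n)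
      (0<scale η′ (suc⁺ n)) (0<scale η n)
      (≃-sym {scale η n} {scale η′ (suc⁺ n)} (scale-glue {ω} {t} {t′} t≃1 t′≃0 n))) S })

ν-≈ : ∀ {η η′} → η ≈Ω η′ → ∀ A → ν η A ≃ ν η′ A
ν-≈ ε A = (λ q∈ → q∈) , (λ q∈ → q∈)
ν-≈ (fwd g ◅ gs) A = (λ q∈ → proj₁ (ν-≈ gs A) (proj₁ (ν-≃ g A) q∈)) , (λ q∈ → proj₂ (ν-≃ g A) (proj₂ (ν-≈ gs A) q∈))
ν-≈ (bwd g ◅ gs) A = (λ q∈ → proj₁ (ν-≈ gs A) (proj₂ (ν-≃ g A) q∈)) , (λ q∈ → proj₁ (ν-≃ g A) (proj₂ (ν-≈ gs A) q∈))

-- Backward orbits dominate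

ℕ⁺-≡ : ∀ {m n : ℕ⁺} → proj₁ m ≡ proj₁ n → m ≡ n
ℕ⁺-≡ {suc m , _} {suc n , _} refl = refl

τ^-suc : ∀ k ω → τ^ (ℤ.- (ℤ.+ suc k)) ω ≡ τ⁻¹ (τ^ (ℤ.- (ℤ.+ k)) ω)
τ^-suc zero    ω = refl
τ^-suc (suc k) ω = refl

τ^-⊕ : ∀ ω k (A : 𝒫) → A ∈ sets (τ^ (ℤ.- (ℤ.+ k)) ω) → (A ⊕ k) ∈ sets ω
τ^-⊕ ω zero    A A∈ = upward ω (λ {n} n∈A → n , n∈A , ℕ.+-identityʳ (proj₁ n)) A∈
τ^-⊕ ω (suc k) A A∈ = upward ω {suc⁺[ A ] ⊕ k} {A ⊕ suc k}
  (λ { (_ , (n , n∈A , refl) , eq) → n , n∈A , trans (ℕ.+-suc (proj₁ n) k) eq })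
  (τ^-⊕ ω k suc⁺[ A ] (subst (λ ω′ → A ∈ sets ω′) (τ^-suc k ω) A∈))

⊕-τ^ : ∀ ω k (A : 𝒫) → (A ⊕ k) ∈ sets ω → A ∈ sets (τ^ (ℤ.- (ℤ.+ k)) ω)
⊕-τ^ ω zero    A A∈ = upward ω {A ⊕ 0} {A}
  (λ { (n , n∈A , eq) → subst A (ℕ⁺-≡ (trans (sym (ℕ.+-identityʳ (proj₁ n))) eq)) n∈A }) A∈
⊕-τ^ ω (suc k) A A∈ = subst (λ ω′ → A ∈ sets ω′) (sym (τ^-suc k ω)) (⊕-τ^ ω k suc⁺[ A ]
  (upward ω {A ⊕ suc k} {suc⁺[ A ] ⊕ k}
    (λ { (n , n∈A , eq) → suc⁺ n , (n , n∈A , refl) , trans (sym (ℕ.+-suc (proj₁ n) k)) eq }) A∈))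

-- This identifies the ultrafilter reached by a gluing step from `τ^(-k) ω`. It is an `≈` because
-- `τ` cancels `τ⁻¹` only up to `≈`.
ττ^ : ∀ k ω → τ (τ^ (ℤ.- (ℤ.+ k)) ω) ≈ τ^ (ℤ.suc (ℤ.- (ℤ.+ k))) ω
ττ^ zero          ω = (λ A∈ → A∈) , (λ A∈ → A∈)
ττ^ (suc zero)    ω = τ-τ⁻¹ ω
ττ^ (suc (suc k)) ω = τ-τ⁻¹ (τ^ (ℤ.- (ℤ.+ suc k)) ω)

-∈ : ∀ x {q u} → u ∉ cut x → q ℚ.< ℚ.- u → q ∈ cut (- x)
-∈ x u∉x q<-u = _ , q<-u , _ , u∉x , refl

+∈ : ∀ x y {q a r} → a ∈ cut x → q ℚ.< a ℚ.+ r → (∀ {b} → b ℚ.< r → b ∈ cut y) → q ∈ cut (x + y)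
+∈ x y {q} {a} {r} a∈x q<a+r f =
  let b , q-a<b , b<r = ℚ.<-dense (subst (q ℚ.- a ℚ.<_) (solve 2 (λ a r → a :+ r :- a := r) refl a r)
                                         (ℚ.+-monoˡ-< (ℚ.- a) q<a+r))
  in a ℚ.+ b , subst (ℚ._< a ℚ.+ b) (solve 2 (λ a q → a :+ (q :- a) := q) refl a q) (ℚ.+-monoʳ-< a q-a<b) ,
     a , b , a∈x , f b<r , refl

∈- : ∀ x y {q a u} → a ∈ cut x → u ∉ cut y → q ℚ.< a ℚ.- u → q ∈ cut (x - y)
∈- x y a∈x u∉y q<a-u = +∈ x (- y) a∈x q<a-u (-∈ y u∉y)

∈-⁻ : ∀ x y {q} → q ∈ cut (x - y) → ∃ λ a → ∃ λ u → a ∈ cut x × u ∉ cut y × q ℚ.< a ℚ.- u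
∈-⁻ x y (_ , q<a+b , a , b , a∈x , (_ , b<-u , u , u∉y , refl) , refl) =
  a , u , a∈x , u∉y , ℚ.<-trans q<a+b (ℚ.+-monoʳ-< a b<-u)

∈-ℤ : ∀ x z {q} → q ℚ.+ ι z ∈ cut x → q ∈ cut (x - fromℤ z)
∈-ℤ x z {q} q+z∈x = let a , q+z<a , a∈x = rounded x q+z∈x in
  ∈- x (fromℤ z) a∈x (ℚ.<-irrefl refl)
    (subst (ℚ._< a ℚ.- ι z) (solve 2 (λ q z → q :+ z :- z := q) refl q (ι z)) (ℚ.+-monoˡ-< (ℚ.- ι z) q+z<a))

∈-ℤ⁻ : ∀ x z {q} → q ∈ cut (x - fromℤ z) → q ℚ.+ ι z ∈ cut x
∈-ℤ⁻ x z {q} q∈ = let a , u , a∈x , u≮z , q<a-u = ∈-⁻ x (fromℤ z) q∈ in lower x (begin-strict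
  q ℚ.+ ι z          ≤⟨ ℚ.+-monoʳ-≤ q (ℚ.≮⇒≥ u≮z) ⟩
  q ℚ.+ u            <⟨ ℚ.+-monoˡ-< u q<a-u ⟩
  a ℚ.- u ℚ.+ u      ≡⟨ solve 2 (λ a u → a :- u :+ u := a) refl a u ⟩
  a                  ∎) a∈x
  where open ℚ.≤-Reasoning

≤-sub : ∀ x s → 0ℝ ≤ s → x - s ≤ x
≤-sub x s 0≤s {q} q∈ = let a , u , a∈x , u∉s , q<a-u = ∈-⁻ x s q∈ in lower x (begin-strict
  q           <⟨ q<a-u ⟩
  a ℚ.- u     ≤⟨ ℚ.+-monoʳ-≤ a (ℚ.neg-antimono-≤ (ℚ.≮⇒≥ λ u<0 → u∉s (0≤s u<0))) ⟩
  a ℚ.- 0ℚ    ≡⟨ ℚ.+-identityʳ a ⟩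
  a           ∎) a∈x
  where open ℚ.≤-Reasoning

-- Being a record, Wrapped is compared by its arguments; on bare ≪ conversion checking would unfold the limits.
record Wrapped {A : Set₁} (R : A → A → Set₁) (x y : A) : Set₁ where
  constructor wrap
  field unwrap : R x y
open Wrapped

infix 4 _≼_
_≼_ : Ω* → Ω* → Set₁
_≼_ = Wrapped (λ η′ η → ν η′ ≪ ν η)

≼-shift : ∀ η η′ k → (∀ (A : 𝒫) → A ∈ sets (proj₁ η′) → (A ⊕ k) ∈ sets (proj₁ η)) →
          (∀ m n → proj₁ m ℕ.+ k ≡ proj₁ n → scale η′ m ≤ scale η n) → η′ ≼ η
≼-shift η η′ k shift scale≤ = wrap (≪-scaled {ν η′} {ν η} (1/pow (suc k)) (0<1/pow (suc k)) (ν-shift η η′ k shift scale≤))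

≼-Glue : ∀ η η′ → Glue η η′ → η′ ≼ η
≼-Glue η η′ g = wrap (≪-scaled {ν η′} {ν η} 1ℚ (ℚ.positive⁻¹ 1ℚ) λ A {q} q∈ →
  subst (_∈ cut (ν η A)) (sym (ℚ.*-identityʳ q)) (proj₂ (ν-≃ {η} {η′} g A) q∈))

-- As `x ≤ t ≤ 1`, only `z ≤ 1` occurs. For `z = 0` the scales compare because `t′ ≤ t`. For
-- `z = -(j+1)` one has `θ′2^m ≤ 2^(m+1) ≤ 2^(m+j+1) ≤ θ2^(m+j+1)`. For `z = 1` necessarily `t = 1`
-- and `t′ = 0`, and the two points are glued.
≼-back : ∀ ω t t′ x z → x ≤ val t → fromℤ z ≤ x → val t′ ≤ x - fromℤ z → (τ^ z ω , t′) ≼ (ω , t)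
≼-back ω t t′ x (ℤ.+ zero) x≤t z≤x t′≤x-z = ≼-shift (ω , t) (τ^ (ℤ.+ zero) ω , t′) 0 (τ^-⊕ ω 0) scale≤
  where
  t′≤t : val t′ ≤ val t
  t′≤t {q} q∈t′ = x≤t (subst (_∈ cut x) (ℚ.+-identityʳ q) (∈-ℤ⁻ x (ℤ.+ 0) (t′≤x-z q∈t′)))
  scale≤ : ∀ m n → proj₁ m ℕ.+ 0 ≡ proj₁ n → scale (ω , t′) m ≤ scale (ω , t) n
  scale≤ (m , _) (n , _) refl = subst (λ n → 2^ t′ · 2 ℕ.^ m ≤ 2^ t · 2 ℕ.^ n) (sym (ℕ.+-identityʳ m))
    (·-mono (2^ t′) (2^ t) m (2^-mono-≤ t′ t t′≤t))
≼-back ω t t′ x -[1+ j ] x≤t z≤x t′≤x-z = ≼-shift (ω , t) (τ^ -[1+ j ] ω , t′) (suc j) (τ^-⊕ ω (suc j)) scale≤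
  where
  scale≤ : ∀ m n → proj₁ m ℕ.+ suc j ≡ proj₁ n → scale (τ^ -[1+ j ] ω , t′) m ≤ scale (ω , t) n
  scale≤ (m , _) n eq = ·-≤ (2^ t′) m (scale (ω , t) n) λ {a} a∈ → <pow⇒∈scale (ω , t) n (begin-strict
    a ℚ.* pow m        <⟨ ℚ.*-monoˡ-<-pos (pow m) {{pow-pos m}} (2^t≤2 t′ a∈) ⟩
    2ℚ ℚ.* pow m       ≡⟨ pow-suc m ⟨
    pow (suc m)        ≤⟨ pow-mono (ℕ.≤-trans (ℕ.m≤m+n (suc m) j) (ℕ.≤-reflexive (trans (sym (ℕ.+-suc m j)) eq))) ⟩
    pow (proj₁ n)      ∎)
    where open ℚ.≤-Reasoning
≼-back ω t t′ x ℤ.+[1+ zero ] x≤t 1≤x t′≤x-1 = ≼-Glue (ω , t) (τ ω , t′)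
  (glue (≤1 t , λ q<1 → x≤t (1≤x q<1)) (t′≤0 , 0≤ t′))
  where
  t′≤0 : val t′ ≤ 0ℝ
  t′≤0 {q} q∈t′ = subst (ℚ._< 0ℚ) (solve 1 (λ q → q :+ con 1ℚ :- con 1ℚ := q) refl q)
    (ℚ.+-monoˡ-< (ℚ.- 1ℚ) (≤1 t (x≤t (∈-ℤ⁻ x (ℤ.+ 1) (t′≤x-1 q∈t′)))))
≼-back ω t t′ x ℤ.+[1+ suc j ] x≤t z≤x t′≤x-z =
  ⊥-elim (ℚ.<-irrefl refl (≤1 t (x≤t (z≤x (ℚ.<-≤-trans (q<q+1 1ℚ) (ι-mono {ℤ.+ 2} {ℤ.+[1+ suc j ]} (ℤ.+≤+ (ℕ.s≤s (ℕ.s≤s ℕ.z≤n)))))))))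

≼-respˡ : ∀ {η₁ η₂ η} → η₁ ≈Ω η₂ → η₂ ≼ η → η₁ ≼ η
≼-respˡ {η₁} {η₂} η₁≈η₂ (wrap f) = wrap λ ϵ 0<ϵ → proj₁ (f ϵ 0<ϵ) , proj₁ (proj₂ (f ϵ 0<ϵ)) , λ A μA<δ →
  let q , q∉ , q∈ϵ = proj₂ (proj₂ (f ϵ 0<ϵ)) A μA<δ in q , (λ q∈ → q∉ (proj₁ (ν-≈ {η₁} {η₂} η₁≈η₂ A) q∈)) , q∈ϵ

floor-≤ : ∀ (em : ExcludedMiddle 0ℓ) x → fromℤ (floor em x) ≤ x
floor-≤ em x = proj₁ (proj₂ (floor-exists em x))

frac-≤ : ∀ (em : ExcludedMiddle 0ℓ) x → val (frac em x) ≤ x - fromℤ (floor em x)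
frac-≤ em x q∈ = q∈

≼-back-≡ : ∀ ω t η x z → proj₁ η ≡ τ^ z ω → x ≤ val t → fromℤ z ≤ x → val (proj₂ η) ≤ x - fromℤ z → η ≼ (ω , t)
≼-back-≡ ω t (_ , t′) x z refl = ≼-back ω t t′ x z

o₋⇒≼ : ∀ η η′ → η′ ∈ o₋ η → η′ ≼ η
o₋⇒≼ (ω , t) η′ (s , 0≤s , η′≈) = ≼-respˡ {η′} {φ (- s) (ω , t)} {ω , t} η′≈
  (≼-back-≡ ω t (φ (- s) (ω , t)) (val t + - s) (floor (decide ω) (val t + - s)) refl (≤-sub (val t) s 0≤s)
    (floor-≤ (decide ω) (val t + - s)) (frac-≤ (decide ω) (val t + - s)))

-- Landing on a given point of the backward orbit

-- Walking up from a member in steps of `e` eventually leaves the cut, and `first` finds the step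
-- that does so. Differences of reals need such pairs, since one of their terms is witnessed by an
-- upper bound.
gap : ExcludedMiddle 0ℓ → ∀ x e → 0ℚ ℚ.< e → ∃ λ a → a ∈ cut x × a ℚ.+ e ∉ cut x
gap em x e 0<e =
  let a₀ , a₀∈x = inhabited x
      u₀ , u₀∉x = proper x
      N , lt = archimedean-* e (u₀ ℚ.- a₀) 0<e
      P = λ j → a₀ ℚ.+ ιℕ j ℚ.* e ∉ cut x
      n , ¬¬n∈ , n+1∉ = first {P} (λ j → em) (λ ∉x → ∉x (subst (_∈ cut x) (sym (start a₀)) a₀∈x)) N
                     (λ ∈x → u₀∉x (lower x (big a₀ u₀ N lt) ∈x))
  in a₀ ℚ.+ ιℕ n ℚ.* e , decidable-stable em ¬¬n∈ , λ ∈x → n+1∉ (subst (_∈ cut x) (next a₀ n) ∈x)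
  where
  start : ∀ a → a ℚ.+ ιℕ 0 ℚ.* e ≡ a
  start a = trans (cong (a ℚ.+_) (ℚ.*-zeroˡ e)) (ℚ.+-identityʳ a)
  next : ∀ a n → a ℚ.+ ιℕ n ℚ.* e ℚ.+ e ≡ a ℚ.+ ιℕ (suc n) ℚ.* e
  next a n = trans (solve 3 (λ a n e → a :+ n :* e :+ e := a :+ (n :+ con 1ℚ) :* e) refl a (ιℕ n) e)
    (cong (λ m → a ℚ.+ m ℚ.* e) (sym (ιℕ-suc n)))
  big : ∀ a u N → u ℚ.- a ℚ.< ιℕ N ℚ.* e → u ℚ.< a ℚ.+ ιℕ N ℚ.* e
  big a u N lt = subst (ℚ._< a ℚ.+ ιℕ N ℚ.* e) (solve 2 (λ a u → a :+ (u :- a) := u) refl a u) (ℚ.+-monoʳ-< a lt)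

0≤sub : ExcludedMiddle 0ℓ → ∀ x y → y ≤ x → 0ℝ ≤ x - y
0≤sub em x y y≤x {q} q<0 =
  let r , q<r , r<0 = ℚ.<-dense q<0
      a , a∈y , a-r∉y = gap em y (ℚ.- r) (ℚ.neg-antimono-< r<0)
  in ∈- x y (y≤x a∈y) a-r∉y (subst (q ℚ.<_) (solve 2 (λ a r → r := a :- (a :- r)) refl a r) q<r)

sub-sub-≤ : ExcludedMiddle 0ℓ → ∀ x y → x - (x - y) ≤ y
sub-sub-≤ em x y {q} q∈ = decidable-stable em λ q∉y →
  let a , u , a∈x , u∉x-y , q<a-u = ∈-⁻ x (x - y) q∈
  in u∉x-y (∈- x y a∈x q∉y (begin-strict
    u                    ≡⟨ solve 2 (λ a u → u := a :- (a :- u)) refl a u ⟩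
    a ℚ.- (a ℚ.- u)      <⟨ ℚ.+-monoʳ-< a (ℚ.neg-antimono-< q<a-u) ⟩
    a ℚ.- q              ∎))
  where open ℚ.≤-Reasoning

≤-sub-sub : ExcludedMiddle 0ℓ → ∀ x y → y ≤ x - (x - y)
≤-sub-sub em x y {q} q∈y =
  let w , q<w , w∈y = rounded y q∈y
      v , q<v , v<w = ℚ.<-dense q<w
      -- With a gap of width `w − v`, the bounds `x ≤ a + (w − v)` and `w < y` make `a − v` an upper
      -- bound of `x − y`.
      a , a∈x , a+e∉x = gap em x (w ℚ.- v) (0<-diff v<w)
  in ∈- x (x - y) {q} {a} {a ℚ.- v} a∈x
       (λ a-v∈ → let a′ , u′ , a′∈x , u′∉y , a-v<a′-u′ = ∈-⁻ x y a-v∈ in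
         ℚ.<-irrefl refl (begin-strict
           a ℚ.- v                              <⟨ a-v<a′-u′ ⟩
           a′ ℚ.- u′                            <⟨ ℚ.+-mono-< (∉-above x a′∈x a+e∉x) (ℚ.neg-antimono-< (∉-above y w∈y u′∉y)) ⟩
           a ℚ.+ (w ℚ.- v) ℚ.- w                ≡⟨ solve 3 (λ a w v → a :+ (w :- v) :- w := a :- v) refl a w v ⟩
           a ℚ.- v                              ∎))
       (subst (q ℚ.<_) (solve 2 (λ a v → v := a :- (a :- v)) refl a v) q<v)
  where open ℚ.≤-Reasoning

≈-refl : ∀ {ω} → ω ≈ ω
≈-refl = (λ A∈ → A∈) , (λ A∈ → A∈)

-- Going back from t by t − (t′ − k) arrives at t′ − k, whose integer part is −k, or 1 − k if t′ = 1.
module _ (ω : ℕ*) (k : ℕ) (t′ : 𝕀) (x : ℝ) (z : ℤ)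
         (x≤ : ∀ {q} → q ∈ cut x → q ℚ.+ ιℕ k ∈ cut (val t′))
         (≤x : ∀ {q} → q ℚ.+ ιℕ k ∈ cut (val t′) → q ∈ cut x)
         (z≤x : fromℤ z ≤ x) (z-max : ∀ w → fromℤ w ≤ x → w ℤ.≤ z)
         (η : Ω*) (ω-eq : proj₁ η ≡ τ^ z ω)
         (frac≤ : val (proj₂ η) ≤ x - fromℤ z) (≤frac : x - fromℤ z ≤ val (proj₂ η)) where

  private
    -k = ℤ.- (ℤ.+ k)

    ι-k+k : ∀ q → q ℚ.+ ι -k ℚ.+ ιℕ k ≡ q
    ι-k+k q = trans (cong (λ y → q ℚ.+ y ℚ.+ ιℕ k) (ι-neg (ℤ.+ k)))
      (solve 2 (λ q k → q :- k :+ k := q) refl q (ιℕ k))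

    ι-suc-k+k : ∀ q → q ℚ.+ ι (ℤ.suc -k) ℚ.+ ιℕ k ≡ q ℚ.+ 1ℚ
    ι-suc-k+k q = trans (cong (λ y → q ℚ.+ y ℚ.+ ιℕ k) (trans (ι-+ (ℤ.+ 1) -k) (cong (1ℚ ℚ.+_) (ι-neg (ℤ.+ k)))))
      (solve 2 (λ q k → q :+ (con 1ℚ :- k) :+ k := q :+ con 1ℚ) refl q (ιℕ k))

    -k≤z : -k ℤ.≤ z
    -k≤z = z-max -k λ {q} q<-k → ≤x (0≤ t′ (subst (q ℚ.+ ιℕ k ℚ.<_) (trans (cong (ℚ._+ ιℕ k) (ι-neg (ℤ.+ k))) (ℚ.+-inverseˡ (ιℕ k)))
             (ℚ.+-monoˡ-< (ιℕ k) q<-k)))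

    z≤1-k : z ℤ.≤ ℤ.suc -k
    z≤1-k = ℤ.≮⇒≥ λ 1-k<z → ℚ.<-irrefl refl (≤1 t′ (subst (_∈ cut (val t′))
      (trans (cong (ℚ._+ ιℕ k) (sym (ℚ.+-identityˡ (ι (ℤ.suc -k))))) (ι-suc-k+k 0ℚ)) (x≤ (z≤x (ι-mono-< 1-k<z)))))
      where
      ι-mono-< : ∀ {z w} → z ℤ.< w → ι z ℚ.< ι w
      ι-mono-< {z} {w} z<w = ℚ.<-≤-trans (subst (ι z ℚ.<_) (sym (ι-suc z)) (q<q+1 (ι z)))
        (ι-mono (subst (ℤ._≤ w) (ℤ.+-comm (ℤ.+ 1) z) (ℤ.i<j⇒suc[i]≤j z<w)))

    ∈frac : ∀ {q} → q ℚ.+ ι z ℚ.+ ιℕ k ∈ cut (val t′) → q ∈ cut (val (proj₂ η))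
    ∈frac q∈ = ≤frac (∈-ℤ x z (≤x q∈))

    ∈frac⁻ : ∀ {q} → q ∈ cut (val (proj₂ η)) → q ℚ.+ ι z ℚ.+ ιℕ k ∈ cut (val t′)
    ∈frac⁻ q∈ = x≤ (∈-ℤ⁻ x z (frac≤ q∈))

    ω-≈ : ∀ {w ω′} → z ≡ w → ω′ ≈ τ^ w ω → ω′ ≈ proj₁ η
    ω-≈ {ω′ = ω′} refl = subst (ω′ ≈_) (sym ω-eq)

  landing : (τ^ -k ω , t′) ≈Ω η
  landing with z ℤ.≟ -k
  ... | yes z≡-k = fwd (same (ω-≈ { -k } {τ^ -k ω} z≡-k (≈-refl {τ^ -k ω}))
          ((λ {q} q∈ → ∈frac (subst (_∈ cut (val t′)) (sym (trans (cong (λ z → q ℚ.+ ι z ℚ.+ ιℕ k) z≡-k) (ι-k+k q))) q∈)) ,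
           (λ {q} q∈ → subst (_∈ cut (val t′)) (trans (cong (λ z → q ℚ.+ ι z ℚ.+ ιℕ k) z≡-k) (ι-k+k q)) (∈frac⁻ q∈)))) ◅ ε
  -- Now `z = 1 − k`, which forces `t′ = 1` and fractional part 0. One gluing step leads to
  -- `τ (τ^(-k) ω)`, and `ττ^` rewrites that ultrafilter.
  ... | no z≢-k = fwd (glue {τ^ -k ω} {t′} {proj₂ η} (≤1 t′ , 1≤t′) (frac≤0 , 0≤ (proj₂ η))) ◅
          fwd (same (ω-≈ {ℤ.suc -k} {τ (τ^ -k ω)} z≡1-k (ττ^ k ω)) ((λ q∈ → q∈) , (λ q∈ → q∈))) ◅ ε
    where
    z≡1-k : z ≡ ℤ.suc -k
    z≡1-k = ℤ.≤-antisym z≤1-k (ℤ.i<j⇒suc[i]≤j (ℤ.≤∧≢⇒< -k≤z (λ eq → z≢-k (sym eq))))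
    1≤t′ : 1ℝ ≤ val t′
    1≤t′ {q} q<1 = subst (_∈ cut (val t′)) (ι-k+k q) (x≤ (z≤x
      (subst (q ℚ.+ ι -k ℚ.<_) (trans (sym (ι-+ (ℤ.+ 1) -k)) (cong ι (sym z≡1-k))) (ℚ.+-monoˡ-< (ι -k) q<1))))
    frac≤0 : val (proj₂ η) ≤ 0ℝ
    frac≤0 {q} q∈ = subst (ℚ._< 0ℚ) (solve 1 (λ q → q :+ con 1ℚ :- con 1ℚ := q) refl q)
      (ℚ.+-monoˡ-< (ℚ.- 1ℚ) (≤1 t′ (subst (_∈ cut (val t′))
        (trans (cong (λ z → q ℚ.+ ι z ℚ.+ ιℕ k) z≡1-k) (ι-suc-k+k q)) (∈frac⁻ q∈))))

-- The hypothesis is `t′ − k ≤ t`, which makes the time `s = t − (t′ − k)` nonnegative; the two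
-- lemmas on `x - (x - y)` turn `t − s` back into `t′ − k`.
o₋-intro : ∀ ω t t′ k → (∀ {q} → q ℚ.+ ιℕ k ∈ cut (val t′) → q ∈ cut (val t)) →
           (τ^ (ℤ.- (ℤ.+ k)) ω , t′) ∈ o₋ (ω , t)
o₋-intro ω t t′ k t′-k≤t = s , 0≤sub (decide ω) (val t) y y≤t ,
  landing ω k t′ x (floor (decide ω) x)
    (λ q∈ → ∈y⁻ (sub-sub-≤ (decide ω) (val t) y q∈)) (λ q∈ → ≤-sub-sub (decide ω) (val t) y (∈y q∈))
    (floor-≤ (decide ω) x) (proj₂ (proj₂ (floor-exists (decide ω) x)))
    (φ (- s) (ω , t)) refl (frac-≤ (decide ω) x) (λ q∈ → q∈)
  where
  y s x : ℝ
  y = val t′ - fromℤ (ℤ.+ k)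
  s = val t - y
  x = val t + - s
  ∈y : ∀ {q} → q ℚ.+ ιℕ k ∈ cut (val t′) → q ∈ cut y
  ∈y = ∈-ℤ (val t′) (ℤ.+ k)
  ∈y⁻ : ∀ {q} → q ∈ cut y → q ℚ.+ ιℕ k ∈ cut (val t′)
  ∈y⁻ = ∈-ℤ⁻ (val t′) (ℤ.+ k)
  y≤t : y ≤ val t
  y≤t q∈y = t′-k≤t (∈y⁻ q∈y)

o₋-resp : ∀ {η η₁ η₂} → η₁ ≈Ω η₂ → η₂ ∈ o₋ η → η₁ ∈ o₋ η
o₋-resp η₁≈η₂ (s , 0≤s , η₂≈) = s , 0≤s , (η₁≈η₂ ◅◅ η₂≈)

-- Ultrafilters and residues

pigeonhole : ∀ ω K (E : ℕ → 𝒫) → (λ m → ∃ λ i → i ℕ.< K × m ∈ E i) ∈ sets ω → ∃ λ i → i ℕ.< K × E i ∈ sets ω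
pigeonhole ω zero    E E∈ = ⊥-elim (ℕ.n≮0 (proj₁ (proj₂ (proj₂ (nonempty ω E∈)))))
pigeonhole ω (suc K) E E∈ with ultra ω (E K)
... | inj₁ EK∈  = K , ℕ.≤-refl , EK∈
... | inj₂ ∁EK∈ = let i , i<K , Ei∈ = pigeonhole ω K E (upward ω drop (intersection ω E∈ ∁EK∈)) in
                  i , ℕ.m<n⇒m<1+n i<K , Ei∈
  where
  drop : ∀ {m} → (∃ λ i → i ℕ.< suc K × m ∈ E i) × m ∉ E K → ∃ λ i → i ℕ.< K × m ∈ E i
  drop ((i , i<1+K , m∈Ei) , m∉EK) =
    i , ℕ.≤∧≢⇒< (ℕ.s≤s⁻¹ i<1+K) (λ { refl → m∉EK m∈Ei }) , m∈Ei

ultra-⊆⇒≈ : ∀ {ω ω′} → sets ω ⊆ sets ω′ → ω ≈ ω′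
ultra-⊆⇒≈ {ω} {ω′} ω⊆ω′ = ω⊆ω′ , λ {A} → back A
  where
  back : ∀ A → A ∈ sets ω′ → A ∈ sets ω
  back A A∈ω′ with ultra ω A
  ... | inj₁ A∈ω  = A∈ω
  ... | inj₂ ∁A∈ω = let _ , n∈A , n∉A = nonempty ω′ (intersection ω′ A∈ω′ (ω⊆ω′ ∁A∈ω)) in ⊥-elim (n∉A n∈A)

large : ∀ ω k → (λ n → k ℕ.< proj₁ n) ∈ sets ω
large ω zero    = upward ω (λ {n} _ → ℕ.>-nonZero⁻¹ (proj₁ n) {{proj₂ n}}) (≢one∈ ω)
large ω (suc k) with ultra ω (λ n → 1+ k ≡ n)
... | inj₁ k∈  = ⊥-elim (free ω (1+ k) k∈)
... | inj₂ ∁k∈ = upward ω (λ { {n} (k<n , k+1≢n) → ℕ.≤∧≢⇒< k<n (λ eq → k+1≢n (ℕ⁺-≡ eq)) })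
                   (intersection ω (large ω k) ∁k∈)

Residue : ∀ P .{{_ : NonZero P}} → ℕ → 𝒫
Residue P r n = proj₁ n % P ≡ r

residue : ∀ ω P .{{_ : NonZero P}} → ∃ λ r → Residue P r ∈ sets ω
residue ω P = let r , _ , r∈ = pigeonhole ω P (Residue P)
                    (upward ω (λ {n} _ → proj₁ n % P , m%n<n (proj₁ n) P , refl) (≢one∈ ω)) in r , r∈

%-< : ∀ P .{{_ : NonZero P}} m n → m % P ≡ n % P → m ℕ.< n → m ℕ.+ P ℕ.≤ n
%-< P m n eq m<n = begin
  m ℕ.+ P                                ≡⟨ cong (ℕ._+ P) (m≡m%n+[m/n]*n m P) ⟩
  m % P ℕ.+ m / P ℕ.* P ℕ.+ P            ≡⟨ ℕ.+-assoc (m % P) (m / P ℕ.* P) P ⟩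
  m % P ℕ.+ (m / P ℕ.* P ℕ.+ P)          ≡⟨ cong (m % P ℕ.+_) (ℕ.+-comm (m / P ℕ.* P) P) ⟩
  m % P ℕ.+ suc (m / P) ℕ.* P            ≤⟨ ℕ.+-mono-≤ (ℕ.≤-reflexive eq) (ℕ.*-monoˡ-≤ P quotient<) ⟩
  n % P ℕ.+ n / P ℕ.* P                  ≡⟨ m≡m%n+[m/n]*n n P ⟨
  n                                      ∎
  where
  open ℕ.≤-Reasoning
  quotient< : m / P ℕ.< n / P
  quotient< = ℕ.≰⇒> λ n/P≤m/P → ℕ.<⇒≱ m<n (begin
    n                        ≡⟨ m≡m%n+[m/n]*n n P ⟩
    n % P ℕ.+ n / P ℕ.* P    ≤⟨ ℕ.+-mono-≤ (ℕ.≤-reflexive (sym eq)) (ℕ.*-monoˡ-≤ P n/P≤m/P) ⟩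
    m % P ℕ.+ m / P ℕ.* P    ≡⟨ m≡m%n+[m/n]*n m P ⟨
    m                        ∎)

%-+-injective : ∀ P .{{_ : NonZero P}} {m n i j} → m % P ≡ n % P → i ℕ.< P → j ℕ.< P → m ℕ.+ i ≡ n ℕ.+ j → i ≡ j
%-+-injective P {m} {n} {i} {j} m≡n i<P j<P eq = begin
  i                            ≡⟨ m<n⇒m%n≡m i<P ⟨
  i % P                        ≡⟨ [m+kn]%n≡m%n i (m / P) P ⟨
  (i ℕ.+ m / P ℕ.* P) % P      ≡⟨ cong (_% P) (ℕ.+-cancelˡ-≡ (m % P) _ _ shifted) ⟩
  (j ℕ.+ n / P ℕ.* P) % P      ≡⟨ [m+kn]%n≡m%n j (n / P) P ⟩
  j % P                        ≡⟨ m<n⇒m%n≡m j<P ⟩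
  j                            ∎
  where
  open ≡-Reasoning
  split : ∀ m i → m % P ℕ.+ (i ℕ.+ m / P ℕ.* P) ≡ m ℕ.+ i
  split m i = trans (cong (m % P ℕ.+_) (ℕ.+-comm i (m / P ℕ.* P)))
    (trans (sym (ℕ.+-assoc (m % P) (m / P ℕ.* P) i)) (cong (ℕ._+ i) (sym (m≡m%n+[m/n]*n m P))))
  shifted : m % P ℕ.+ (i ℕ.+ m / P ℕ.* P) ≡ m % P ℕ.+ (j ℕ.+ n / P ℕ.* P)
  shifted = begin
    m % P ℕ.+ (i ℕ.+ m / P ℕ.* P)  ≡⟨ split m i ⟩
    m ℕ.+ i                        ≡⟨ eq ⟩
    n ℕ.+ j                        ≡⟨ split n j ⟨
    n % P ℕ.+ (j ℕ.+ n / P ℕ.* P)  ≡⟨ cong (ℕ._+ (j ℕ.+ n / P ℕ.* P)) m≡n ⟨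
    m % P ℕ.+ (j ℕ.+ n / P ℕ.* P)  ∎

-- Unions of blocks

Blocks : 𝒫 → ℚ → ℚ → 𝒫
Blocks B c d m = ∃ λ n → n ∈ B × c ℚ.* pow (proj₁ n) ℚ.< ιℕ (proj₁ m) × ιℕ (proj₁ m) ℚ.≤ d ℚ.* pow (proj₁ n)

-- In use `v` is a rational upper bound of `θ`, so the inequality on the powers holds for every
-- block that meets `{1,…,[θ2^m]}`.
Far : 𝒫 → ℚ → ℚ → ℕ → 𝒫
Far B c v M m = ∀ n → n ∈ B → c ℚ.* pow (proj₁ n) ℚ.< v ℚ.* pow (proj₁ m) → proj₁ n ℕ.+ M ℕ.≤ proj₁ m

module _ (em : ExcludedMiddle 0ℓ) (η : Ω*) (B : 𝒫) (c d v : ℚ) (M : ℕ)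
         (d≤2 : d ℚ.≤ 2ℚ) (v∉ : v ∉ cut (2^ (proj₂ η))) (m : ℕ⁺) (far : m ∈ Far B c v M) where

  private
    m₀ = proj₁ m
    F = ⌊_⌋ em (scale η m)

    F≤ : ιℕ F ℚ.≤ v ℚ.* pow m₀
    F≤ = ⌊⌋-lower em (scale η m) (0<scale η m) (·-∉ (2^ (proj₂ η)) m₀ v∉)

    member : ∀ n → 1+ n ∈ Blocks B c d → n ℕ.< F → ∃ λ b → b ℕ.+ M ℕ.≤ m₀ × suc n ℕ.≤ 2 ℕ.^ suc b
    member n (b , b∈B , c<n , n≤d) n<F =
      proj₁ b , far b b∈B (ℚ.<-≤-trans c<n (ℚ.≤-trans (ιℕ-mono n<F) F≤)) ,
      ιℕ-cancel-≤
        (ℚ.≤-trans n≤d (ℚ.≤-trans (*-monoʳ-≤ (pow (proj₁ b)) (0≤pow (proj₁ b)) d≤2)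
          (ℚ.≤-reflexive (sym (pow-suc (proj₁ b))))))

  -- A block reaching into the range has exponent `b ≤ m − M` and ends by `d · 2^b ≤ 2^(b+1)`, so
  -- every counted element is at most `2^(m−M+1)`. If `M > m`, no block reaches the range and the
  -- count is 0.
  count-Blocks-≤ : count em (Blocks B c d) F ℕ.* 2 ℕ.^ M ℕ.≤ 2 ℕ.^ suc m₀
  count-Blocks-≤ = go (M ℕ.≤? m₀)
    where
    open ℕ.≤-Reasoning
    go : Dec (M ℕ.≤ m₀) → count em (Blocks B c d) F ℕ.* 2 ℕ.^ M ℕ.≤ 2 ℕ.^ suc m₀
    go (no M≰m) = begin
      count em (Blocks B c d) F ℕ.* 2 ℕ.^ M  ≤⟨ ℕ.*-monoˡ-≤ (2 ℕ.^ M) (count-≤ em (Blocks B c d) 0 F λ n n∈ n<F →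
        let b , b+M≤m , _ = member n n∈ n<F in ⊥-elim (M≰m (ℕ.≤-trans (ℕ.m≤n+m M b) b+M≤m))) ⟩
      0                                      ≤⟨ ℕ.z≤n ⟩
      2 ℕ.^ suc m₀                           ∎
    go (yes M≤m) = begin
      count em (Blocks B c d) F ℕ.* 2 ℕ.^ M  ≤⟨ ℕ.*-monoˡ-≤ (2 ℕ.^ M) (count-≤ em (Blocks B c d) (2 ℕ.^ suc (m₀ ℕ.∸ M)) F λ n n∈ n<F →
        let b , b+M≤m , n<2^ = member n n∈ n<F in
        ℕ.≤-trans n<2^ (ℕ.^-monoʳ-≤ 2 (ℕ.s≤s (ℕ.m+n≤o⇒m≤o∸n b b+M≤m)))) ⟩
      2 ℕ.^ suc (m₀ ℕ.∸ M) ℕ.* 2 ℕ.^ M       ≡⟨ ℕ.^-distribˡ-+-* 2 (suc (m₀ ℕ.∸ M)) M ⟨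
      2 ℕ.^ suc (m₀ ℕ.∸ M ℕ.+ M)             ≡⟨ cong (λ k → 2 ℕ.^ suc k) (ℕ.m∸n+n≡m M≤m) ⟩
      2 ℕ.^ suc m₀                           ∎

  Density-Blocks-≤ : ∀ {e} → 0ℚ ℚ.< e → 2ℚ ℚ.< e ℚ.* pow M → e ∉ Density em (Blocks B c d) (scale η m)
  Density-Blocks-≤ {e} 0<e 2<e (r , e<r , u , u∉ , ru≤) = ℚ.<-irrefl refl (begin-strict
    2ℚ ℚ.* pow m₀                    <⟨ ℚ.*-monoˡ-<-pos (pow m₀) {{pow-pos m₀}} 2<e ⟩
    e ℚ.* pow M ℚ.* pow m₀           ≤⟨ *-monoʳ-≤ (pow m₀) (0≤pow m₀) (*-monoʳ-≤ (pow M) (0≤pow M) (ℚ.<⇒≤ e<r)) ⟩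
    r ℚ.* pow M ℚ.* pow m₀           ≡⟨ solve 3 (λ r a b → r :* a :* b := r :* b :* a) refl r (pow M) (pow m₀) ⟩
    r ℚ.* pow m₀ ℚ.* pow M           ≤⟨ *-monoʳ-≤ (pow M) (0≤pow M)
                                          (ℚ.≤-trans (*-monoˡ-≤ r (ℚ.<⇒≤ (ℚ.<-trans 0<e e<r)) (pow≤scale η m u∉)) ru≤) ⟩
    ιℕ #A ℚ.* pow M                  ≡⟨ ιℕ-* #A (2 ℕ.^ M) ⟨
    ιℕ (#A ℕ.* 2 ℕ.^ M)              ≤⟨ ιℕ-mono count-Blocks-≤ ⟩
    pow (suc m₀)                     ≡⟨ pow-suc m₀ ⟩
    2ℚ ℚ.* pow m₀                    ∎)
    where
    open ℚ.≤-Reasoning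
    #A = count em (Blocks B c d) F

ν-Blocks-≤ : ∀ η B c d v M → d ℚ.≤ 2ℚ → v ∉ cut (2^ (proj₂ η)) → Far B c v M ∈ sets (proj₁ η) →
             ∀ {e} → 0ℚ ℚ.< e → 2ℚ ℚ.< e ℚ.* pow M → e ∉ cut (ν η (Blocks B c d))
ν-Blocks-≤ η@(ω , t) B c d v M d≤2 v∉ far {e} 0<e 2<e e∈ = contradict (ν-∈⁻ η (Blocks B c d) e∈)
  where
  contradict : (∃ λ p → e ℚ.< p × (λ n → p ∈ Density (decide ω) (Blocks B c d) (scale η n)) ∈ sets ω) → ⊥
  contradict (p , e<p , p∈) =
    let m , (p∈m , far-m) = nonempty ω (intersection ω p∈ far)
        0<p = ℚ.<-trans 0<e e<p
    in Density-Blocks-≤ (decide ω) η B c d v M d≤2 v∉ m far-m 0<p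
         (ℚ.<-trans 2<e (ℚ.*-monoˡ-<-pos (pow M) {{pow-pos M}} e<p)) p∈m

module _ (em : ExcludedMiddle 0ℓ) (η : Ω*) (B : 𝒫) (c d : ℚ) (0≤c : 0ℚ ℚ.≤ c)
         (d∈ : d ∈ cut (2^ (proj₂ η))) (n : ℕ⁺) (n∈B : n ∈ B) (2≤ : 2ℚ ℚ.≤ (d ℚ.- c) ℚ.* pow (proj₁ n)) where

  private
    n₀ = proj₁ n
    F = ⌊_⌋ em (scale η n)
    #A = count em (Blocks B c d) F

  -- The block of the exponent `n` alone gives the bound.
  count-Blocks-≥ : d ℚ.* pow n₀ ℚ.≤ c ℚ.* pow n₀ ℚ.+ ιℕ #A ℚ.+ 1ℚ
  count-Blocks-≥ = go (count-≥ em (Blocks B c d) (c ℚ.* pow n₀) (d ℚ.* pow n₀) (0≤* 0≤c (0≤pow n₀))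
      (λ m c<m m≤d → n , n∈B , c<m , m≤d) F)
    where
    go : ιℕ F ℚ.≤ c ℚ.* pow n₀ ℚ.+ ιℕ #A ⊎ d ℚ.* pow n₀ ℚ.≤ c ℚ.* pow n₀ ℚ.+ ιℕ #A ℚ.+ 1ℚ →
         d ℚ.* pow n₀ ℚ.≤ c ℚ.* pow n₀ ℚ.+ ιℕ #A ℚ.+ 1ℚ
    go (inj₂ ≤#A) = ≤#A
    -- The range may stop short of the end of the block, but by less than 1: `d < θ` gives
    -- `d · 2^n ≤ [θ2^n] + 1`.
    go (inj₁ F≤)  = ℚ.≤-trans (⌊⌋-upper em (scale η n) (0<scale η n) (·-∈ (2^ (proj₂ η)) n₀ d∈)) (ℚ.+-monoˡ-≤ 1ℚ F≤)

  -- One factor ½ comes from the denominator, at most `2 · 2^n`; the other pays for the rounding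
  -- error 1, which is at most half of `(d − c) · 2^n`.
  Density-Blocks-≥ : ∀ {p} → p ℚ.< (d ℚ.- c) ℚ.* (½ ℚ.* ½) → p ∈ Density em (Blocks B c d) (scale η n)
  Density-Blocks-≥ {p} p<e = let r , p<r , r<e = ℚ.<-dense p<e in
    r , p<r , 2ℚ ℚ.* pow n₀ , ·-∉ (2^ (proj₂ η)) n₀ (2∉2^ (proj₂ η)) , (begin
      r ℚ.* (2ℚ ℚ.* pow n₀)                           ≤⟨ *-monoʳ-≤ (2ℚ ℚ.* pow n₀)
                                                           (0≤* (ℚ.nonNegative⁻¹ 2ℚ) (0≤pow n₀)) (ℚ.<⇒≤ r<e) ⟩
      (d ℚ.- c) ℚ.* (½ ℚ.* ½) ℚ.* (2ℚ ℚ.* pow n₀)     ≡⟨ solve 2 (λ e P → e :* (con ½ :* con ½) :* (con 2ℚ :* P)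
                                                           := e :* P :- e :* P :* con ½) refl (d ℚ.- c) (pow n₀) ⟩
      D ℚ.- D ℚ.* ½                                   ≤⟨ ℚ.+-monoʳ-≤ D (ℚ.neg-antimono-≤ (*-monoʳ-≤ ½ (ℚ.nonNegative⁻¹ ½) 2≤)) ⟩
      D ℚ.- 1ℚ                                        ≡⟨ solve 3 (λ c d P → (d :- c) :* P :- con 1ℚ
                                                           := d :* P :- (c :* P :+ con 1ℚ)) refl c d (pow n₀) ⟩
      d ℚ.* pow n₀ ℚ.- (c ℚ.* pow n₀ ℚ.+ 1ℚ)          ≤⟨ ℚ.+-monoˡ-≤ (ℚ.- (c ℚ.* pow n₀ ℚ.+ 1ℚ)) count-Blocks-≥ ⟩
      c ℚ.* pow n₀ ℚ.+ ιℕ #A ℚ.+ 1ℚ ℚ.- (c ℚ.* pow n₀ ℚ.+ 1ℚ)  ≡⟨ solve 2 (λ C A → C :+ A :+ con 1ℚ :- (C :+ con 1ℚ)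
                                                           := A) refl (c ℚ.* pow n₀) (ιℕ #A) ⟩
      ιℕ #A                                           ∎)
    where
    open ℚ.≤-Reasoning
    D = (d ℚ.- c) ℚ.* pow n₀

ν-Blocks-≥ : ∀ η B c d → 0ℚ ℚ.≤ c → c ℚ.< d → d ∈ cut (2^ (proj₂ η)) → B ∈ sets (proj₁ η) →
             ∀ {q} → q ℚ.< (d ℚ.- c) ℚ.* (½ ℚ.* ½) → q ∈ cut (ν η (Blocks B c d))
ν-Blocks-≥ η@(ω , t) B c d 0≤c c<d d∈ B∈ {q} q<e =
  let p , q<p , p<e = ℚ.<-dense q<e
      n₁ , 2< = archimedean-pow (d ℚ.- c) 2ℚ (0<-diff c<d)
  in ν-∈ η (Blocks B c d) (p , q<p , upward ω {B = λ n → p ∈ Density (decide ω) (Blocks B c d) (scale η n)}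
       (λ { {n} (n∈B , n₁<n) → Density-Blocks-≥ (decide ω) η B c d 0≤c d∈ n n∈B
         (ℚ.≤-trans (ℚ.<⇒≤ 2<) (*-monoˡ-≤ (d ℚ.- c) (ℚ.<⇒≤ (0<-diff c<d)) (pow-mono (ℕ.<⇒≤ n₁<n)))) p<e })
       (intersection ω B∈ (large ω n₁)))

-- Absolute continuity

-- Take `ϵ = (d − c)/4`, the lower bound of `ν-Blocks-≥`, and `M` with `2 · 2^(-M) < δ₀ < δ`. If the
-- exponents of some `B` were far, the blocks would have `ν η` below `δ` but `ν η′` not below `ϵ`.
≪⇒near : ∀ η η′ → ν η′ ≪ ν η → ∀ c d v → 0ℚ ℚ.≤ c → c ℚ.< d → d ∈ cut (2^ (proj₂ η′)) → v ∉ cut (2^ (proj₂ η)) →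
         ∃ λ M → ∀ B → B ∈ sets (proj₁ η′) → Far B c v M ∉ sets (proj₁ η)
≪⇒near η η′ ν′≪ν c d v 0≤c c<d d∈ v∉ =
  let δ , 0<δ , ν′<ϵ = ν′≪ν (fromℚ e) (0ℚ , ℚ.<-irrefl refl , 0<e)
      δ₀ , δ₀-pos , δ₀∈δ = 0<⇒positive δ 0<δ
      0<δ₀ = ℚ.positive⁻¹ δ₀ {{δ₀-pos}}
      M , 2< = archimedean-pow δ₀ 2ℚ 0<δ₀
  in M , λ B B∈ far →
    let q , q∉ , q<e = ν′<ϵ (Blocks B c d)
          (δ₀ , ν-Blocks-≤ η B c d v M (ℚ.<⇒≤ (2^t≤2 (proj₂ η′) d∈)) v∉ far 0<δ₀ 2< , δ₀∈δ)
    in q∉ (ν-Blocks-≥ η′ B c d 0≤c c<d d∈ B∈ q<e)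
  where
  e = (d ℚ.- c) ℚ.* (½ ℚ.* ½)
  0<e : 0ℚ ℚ.< e
  0<e = ℚ.positive⁻¹ e {{ℚ.pos*pos⇒pos (d ℚ.- c) {{ℚ.positive (0<-diff c<d)}} (½ ℚ.* ½)}}

-- The offset by one lets a natural `i` cover the forward translate as well: `i = 0` corresponds to
-- `τ ω`, and `i = k + 1` to `τ^(-k) ω`.
Shifted : ℕ → 𝒫 → 𝒫
Shifted i B m = ∃ λ n → n ∈ B × proj₁ n ℕ.+ i ≡ suc (proj₁ m)

pow-cancel-scaled : ∀ {a b} m n → 0ℚ ℚ.< a → a ℚ.≤ b → b ℚ.* pow m ℚ.< a ℚ.* pow n → m ℕ.< n
pow-cancel-scaled {a} {b} m n 0<a a≤b lt = pow-cancel-< (ℚ.*-cancelˡ-<-nonNeg a {{ℚ.nonNegative (ℚ.<⇒≤ 0<a)}}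
  (ℚ.≤-<-trans (*-monoʳ-≤ (pow m) (0≤pow m) a≤b) lt))

-- The residue class of the exponents modulo M + 1 pins down the shift i, so the same i works for every B.
module _ (ω ω′ : ℕ*) (M : ℕ) (near : ∀ B → B ∈ sets ω′ → Far B ½ 2ℚ M ∉ sets ω) where

  private
    far : ∀ B {m} → ¬ (∃ λ i → i ℕ.< suc M × m ∈ Shifted i B) → m ∈ Far B ½ 2ℚ M
    -- With `c = ½` and `v = 2` the inequality says `n ≤ m + 1`. If also `m < n + M`, then
    -- `i = m + 1 − n` is between 0 and `M`, contrary to `none`.
    far B {m , _} none n@(n₀ , _) n∈B ½<2 = ℕ.≮⇒≥ λ m<n+M → none
      (suc m ℕ.∸ n₀ , ℕ.s≤s (ℕ.≤-trans (ℕ.∸-monoˡ-≤ n₀ m<n+M) (ℕ.≤-reflexive (ℕ.m+n∸m≡n n₀ M))) ,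
       n , n∈B , ℕ.m+[n∸m]≡n n≤1+m)
      where
      n≤1+m : n₀ ℕ.≤ suc m
      n≤1+m = ℕ.s≤s⁻¹ (pow-cancel-< (begin-strict
        pow n₀                       ≡⟨ solve 1 (λ x → x := con 2ℚ :* (con ½ :* x)) refl (pow n₀) ⟩
        2ℚ ℚ.* (½ ℚ.* pow n₀)        <⟨ ℚ.*-monoʳ-<-pos 2ℚ ½<2 ⟩
        2ℚ ℚ.* (2ℚ ℚ.* pow m)        ≡⟨ cong (2ℚ ℚ.*_) (pow-suc m) ⟨
        2ℚ ℚ.* pow (suc m)           ≡⟨ pow-suc (suc m) ⟨
        pow (suc (suc m))            ∎))
        where open ℚ.≤-Reasoning

  near⇒shifted : ∀ B → B ∈ sets ω′ → ∃ λ i → i ℕ.< suc M × Shifted i B ∈ sets ω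
  near⇒shifted B B∈ with ultra ω (λ m → ∃ λ i → i ℕ.< suc M × m ∈ Shifted i B)
  ... | inj₁ some = pigeonhole ω (suc M) (λ i → Shifted i B) some
  ... | inj₂ none = ⊥-elim (near B B∈ (upward ω (λ {m} → far B {m}) none))

  near⇒shifted-uniformly : ∃ λ i → ∀ B → B ∈ sets ω′ → Shifted i B ∈ sets ω
  near⇒shifted-uniformly = go (residue ω′ (suc M))
    where
    go : (∃ λ r → Residue (suc M) r ∈ sets ω′) → ∃ λ i → ∀ B → B ∈ sets ω′ → Shifted i B ∈ sets ω
    go (r , C∈) = go′ (near⇒shifted C C∈)
      where
      C = Residue (suc M) r
      go′ : (∃ λ i → i ℕ.< suc M × Shifted i C ∈ sets ω) → ∃ λ i → ∀ B → B ∈ sets ω′ → Shifted i B ∈ sets ω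
      go′ (i₀ , i₀<P , i₀∈) = i₀ , λ B B∈ →
        let i , i<P , i∈ = near⇒shifted (λ n → n ∈ B × n ∈ C) (intersection ω′ B∈ C∈)
            -- A common point `m` of the two translates gives `n + i = m + 1 = n′ + i₀` with `n` and
            -- `n′` in the same residue class.
            _ , (n , (_ , n∈C) , eq) , (n′ , n′∈C , eq′) = nonempty ω (intersection ω i∈ i₀∈)
            i≡i₀ = %-+-injective (suc M) {proj₁ n} {proj₁ n′} (trans n∈C (sym n′∈C)) i<P i₀<P (trans eq (sym eq′))
        in subst (λ i → Shifted i B ∈ sets ω) i≡i₀
             (upward ω (λ { (n , (n∈B , _) , eq) → n , n∈B , eq }) i∈)

≪⇒shifted : ∀ η η′ → ν η′ ≪ ν η → ∃ λ i → ∀ B → B ∈ sets (proj₁ η′) → Shifted i B ∈ sets (proj₁ η)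
≪⇒shifted η@(ω , t) η′@(ω′ , t′) ν′≪ν =
  -- `d < 1 ≤ θ′` and `v = 2 ≥ θ` suit all `t` and `t′`, so the argument concerns the ultrafilters
  -- alone.
  let d , ½<d , d<1 = ℚ.<-dense {½} {1ℚ} (ℚ.*<* (ℤ.+<+ (ℕ.s≤s (ℕ.s≤s ℕ.z≤n))))
      M , near = ≪⇒near η η′ ν′≪ν ½ d 2ℚ (ℚ.nonNegative⁻¹ ½) ½<d (1≤2^t t′ d<1) (2∉2^ t)
  in near⇒shifted-uniformly ω ω′ M near

-- Blocks at exponents in a residue class modulo M + j + 1 are too sparse.
near⇒¬sparse : ∀ (ω ω′ : ℕ*) c v M j →
               (∀ (C : 𝒫) → C ∈ sets ω′ → (λ m → ∃ λ x → x ∈ C × proj₁ x ≡ proj₁ m ℕ.+ j) ∈ sets ω) →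
               (∀ B → B ∈ sets ω′ → Far B c v M ∉ sets ω) →
               ¬ (∀ n m → c ℚ.* pow n ℚ.< v ℚ.* pow m → n ℕ.< m ℕ.+ j)
near⇒¬sparse ω ω′ c v M j shift near <⇒< =
  let r , C∈ = residue ω′ P in near (Residue P r) C∈ (upward ω (λ {m} → far r {m}) (shift (Residue P r) C∈))
  where
  P = suc (M ℕ.+ j)
  far : ∀ r {m} → (∃ λ x → x ∈ Residue P r × proj₁ x ≡ proj₁ m ℕ.+ j) → m ∈ Far (Residue P r) c v M
  -- Both `n` and `m + j` lie in the class and `n < m + j`, so they differ by at least `P > M + j`;
  -- cancelling `j` still leaves `M`.
  far r {m , _} ((x , _) , x∈C , refl) (n , _) n∈C lt = ℕ.+-cancelʳ-≤ j (n ℕ.+ M) m (begin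
    n ℕ.+ M ℕ.+ j        ≡⟨ ℕ.+-assoc n M j ⟩
    n ℕ.+ (M ℕ.+ j)      ≤⟨ ℕ.+-monoʳ-≤ n (ℕ.n≤1+n (M ℕ.+ j)) ⟩
    n ℕ.+ P              ≤⟨ %-< P n (m ℕ.+ j) (trans n∈C (sym x∈C)) (<⇒< n m lt) ⟩
    m ℕ.+ j              ∎)
    where open ℕ.≤-Reasoning

≪⇒¬sparse : ∀ η η′ → ν η′ ≪ ν η → ∀ j →
            (∀ (C : 𝒫) → C ∈ sets (proj₁ η′) → (λ m → ∃ λ x → x ∈ C × proj₁ x ≡ proj₁ m ℕ.+ j) ∈ sets (proj₁ η)) →
            ∀ c d v → 0ℚ ℚ.≤ c → c ℚ.< d → d ∈ cut (2^ (proj₂ η′)) → v ∉ cut (2^ (proj₂ η)) →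
            ¬ (∀ n m → c ℚ.* pow n ℚ.< v ℚ.* pow m → n ℕ.< m ℕ.+ j)
≪⇒¬sparse η η′ ν′≪ν j shift c d v 0≤c c<d d∈ v∉ =
  let M , near = ≪⇒near η η′ ν′≪ν c d v 0≤c c<d d∈ v∉
  in near⇒¬sparse (proj₁ η) (proj₁ η′) c v M j shift near

-- Comparison of the second coordinates

1≤∉2^ : ∀ t {c} → c ∉ cut (2^ t) → 1ℚ ℚ.≤ c
1≤∉2^ t c∉ = ℚ.≮⇒≥ λ c<1 → c∉ (1≤2^t t c<1)

0𝕀 1𝕀 : 𝕀
0𝕀 = record { val = 0ℝ ; 0≤ = λ q<0 → q<0 ; ≤1 = λ q<0 → ℚ.<-trans q<0 (ℚ.positive⁻¹ 1ℚ) }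
1𝕀 = record { val = 1ℝ ; 0≤ = λ q<0 → ℚ.<-trans q<0 (ℚ.positive⁻¹ 1ℚ) ; ≤1 = λ q<1 → q<1 }

-- If `t < t′`, choose `c` with `θ ≤ c < θ′`. With `v = c` the inequality `c · 2^n < c · 2^m` means
-- `n < m`, which `≪⇒¬sparse` excludes for `j = 0`.
≪⇒≤ : ∀ ω ω′ t t′ → ω′ ≈ ω → ν (ω′ , t′) ≪ ν (ω , t) → val t′ ≤ val t
≪⇒≤ ω ω′ t t′ (ω′⊆ω , _) ν′≪ν q∈t′ = decidable-stable (decide ω) λ q∉t →
  let c , c∉ , c∈ = 2^-strict t t′ q∉t q∈t′
      d , c<d , d∈ = rounded (2^ t′) c∈
      0<c = ℚ.<-≤-trans (ℚ.positive⁻¹ 1ℚ) (1≤∉2^ t c∉)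
  in ≪⇒¬sparse (ω , t) (ω′ , t′) ν′≪ν 0
       (λ C C∈ → upward ω (λ {m} m∈C → m , m∈C , sym (ℕ.+-identityʳ (proj₁ m))) (ω′⊆ω C∈))
       c d c (ℚ.<⇒≤ 0<c) c<d d∈ c∉
       (λ n m lt → subst (n ℕ.<_) (sym (ℕ.+-identityʳ m)) (pow-cancel-scaled n m 0<c ℚ.≤-refl lt))

module _ (ω ω′ : ℕ*) (t t′ : 𝕀) (ω′≈τω : ω′ ≈ τ ω) (ν′≪ν : ν (ω′ , t′) ≪ ν (ω , t)) where

  private
    shift : ∀ (C : 𝒫) → C ∈ sets ω′ → (λ m → ∃ λ x → x ∈ C × proj₁ x ≡ proj₁ m ℕ.+ 1) ∈ sets ω
    shift C C∈ = upward ω (λ {m} m+1∈C → suc⁺ m , m+1∈C , ℕ.+-comm 1 (proj₁ m)) (proj₁ ω′≈τω C∈)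

    ≤pow-suc : ∀ {c v} n m → 1ℚ ℚ.≤ c → v ℚ.* pow m ℚ.≤ c ℚ.* pow (suc m) → c ℚ.* pow n ℚ.< v ℚ.* pow m → n ℕ.< m ℕ.+ 1
    ≤pow-suc {c} n m 0<c le lt = subst (n ℕ.<_) (ℕ.+-comm 1 m)
      (pow-cancel-scaled {c} n (suc m) (ℚ.<-≤-trans (ℚ.positive⁻¹ 1ℚ) 0<c) ℚ.≤-refl (ℚ.<-≤-trans lt le))

  -- If `t < 1`, choose `v` with `θ ≤ v < 2` and put `c = v/2 < 1 ≤ θ′`. Then `c · 2^n < v · 2^m`
  -- means `n < m + 1`, the excluded case `j = 1`.
  ≪⇒1≤ : 1ℝ ≤ val t
  ≪⇒1≤ q<1 = decidable-stable (decide ω) λ q∉t →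
    let v , v∉ , v∈ = 2^-strict t 1𝕀 q∉t q<1
        0<v = ℚ.<-≤-trans (ℚ.positive⁻¹ 1ℚ) (1≤∉2^ t v∉)
        d , c<d , d<1 = ℚ.<-dense (ℚ.*-monoˡ-<-pos ½ (2^t≤2 1𝕀 v∈))
        0<c = subst (ℚ._< v ℚ.* ½) (ℚ.*-zeroˡ ½) (ℚ.*-monoˡ-<-pos ½ 0<v)
    in ≪⇒¬sparse (ω , t) (ω′ , t′) ν′≪ν 1 shift (v ℚ.* ½) d v (ℚ.<⇒≤ 0<c) c<d (1≤2^t t′ d<1) v∉
         (λ n m lt → subst (n ℕ.<_) (ℕ.+-comm 1 m) (pow-cancel-scaled n (suc m) 0<c ℚ.≤-refl
           (subst (v ℚ.* ½ ℚ.* pow n ℚ.<_)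
             (trans (solve 2 (λ v x → v :* x := v :* con ½ :* (con 2ℚ :* x)) refl v (pow m))
               (cong (v ℚ.* ½ ℚ.*_) (sym (pow-suc m)))) lt)))

  -- If `t′ > 0`, choose `c` with `1 ≤ c < θ′` and take `v = 2 ≥ θ`. Then `c · 2^n < 2 · 2^m` again
  -- gives `n < m + 1`.
  ≪⇒≤0 : val t′ ≤ 0ℝ
  ≪⇒≤0 {q} q∈t′ = ℚ.≰⇒> λ 0≤q →
    let c , c∉ , c∈ = 2^-strict 0𝕀 t′ (λ q<0 → <⇒≱ q<0 0≤q) q∈t′
        d , c<d , d∈ = rounded (2^ t′) c∈
        1≤c = 1≤∉2^ 0𝕀 c∉
    in ≪⇒¬sparse (ω , t) (ω′ , t′) ν′≪ν 1 shift c d 2ℚ (ℚ.≤-trans (ℚ.nonNegative⁻¹ 1ℚ) 1≤c) c<d d∈ (2∉2^ t)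
         (λ n m lt → subst (n ℕ.<_) (ℕ.+-comm 1 m) (pow-cancel-scaled {1ℚ} {c} n (suc m) (ℚ.positive⁻¹ 1ℚ) 1≤c
           (subst (c ℚ.* pow n ℚ.<_) (trans (sym (pow-suc m)) (sym (ℚ.*-identityˡ (pow (suc m))))) lt)))

≪⇒o₋ : ∀ η η′ → ν η′ ≪ ν η → η′ ∈ o₋ η
≪⇒o₋ (ω , t) (ω′ , t′) ν′≪ν = conclude (≪⇒shifted (ω , t) (ω′ , t′) ν′≪ν)
  where
  conclude : (∃ λ i → ∀ B → B ∈ sets ω′ → Shifted i B ∈ sets ω) → (ω′ , t′) ∈ o₋ (ω , t)
  -- Here `ω′` is `τ ω`, and absolute continuity forces `t = 1` and `t′ = 0`. The point is thus
  -- glued to `(ω , t)`, which lies in its own backward orbit.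
  conclude (zero , shifted) = o₋-resp {ω , t} {ω′ , t′} {ω , t}
    (fwd (same {ω′} {τ ω} {t′} {t′} ω′≈τω ((λ q∈ → q∈) , (λ q∈ → q∈))) ◅
     bwd (glue {ω} {t} {t′} (≤1 t , ≪⇒1≤ ω ω′ t t′ ω′≈τω ν′≪ν) (≪⇒≤0 ω ω′ t t′ ω′≈τω ν′≪ν , 0≤ t′)) ◅ ε)
    (o₋-intro ω t t 0 (λ {q} → subst (_∈ cut (val t)) (ℚ.+-identityʳ q)))
    where
    ω′≈τω : ω′ ≈ τ ω
    ω′≈τω = ultra-⊆⇒≈ {ω′} {τ ω} λ {B} B∈ → upward ω
      (λ { (n , n∈B , eq) → subst B (ℕ⁺-≡ (trans (sym (ℕ.+-identityʳ (proj₁ n))) eq)) n∈B }) (shifted B B∈)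
  conclude (suc k , shifted) = o₋-resp {ω , t} {ω′ , t′} {τ^ (ℤ.- (ℤ.+ k)) ω , t′}
    (fwd (same {ω′} {τ^ (ℤ.- (ℤ.+ k)) ω} {t′} {t′} ω′≈ ((λ q∈ → q∈) , (λ q∈ → q∈))) ◅ ε) (o₋-intro ω t t′ k (t′-k≤t k ω′≈))
    where
    ω′≈ : ω′ ≈ τ^ (ℤ.- (ℤ.+ k)) ω
    ω′≈ = ultra-⊆⇒≈ {ω′} {τ^ (ℤ.- (ℤ.+ k)) ω} λ {B} B∈ → ⊕-τ^ ω k B (upward ω
      (λ { (n , n∈B , eq) → n , n∈B , ℕ.suc-injective (trans (sym (ℕ.+-suc (proj₁ n) k)) eq) }) (shifted B B∈))
    t′-k≤t : ∀ k → ω′ ≈ τ^ (ℤ.- (ℤ.+ k)) ω → ∀ {q} → q ℚ.+ ιℕ k ∈ cut (val t′) → q ∈ cut (val t)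
    t′-k≤t zero    ω′≈ω {q} q∈t′ = ≪⇒≤ ω ω′ t t′ ω′≈ω ν′≪ν (subst (_∈ cut (val t′)) (ℚ.+-identityʳ q) q∈t′)
    -- Since `t′ ≤ 1`, the number `t′ − (k + 1)` is at most 0 and so at most `t`.
    t′-k≤t (suc k) _ {q} q+k∈t′ = 0≤ t (ℚ.≰⇒> λ 0≤q → <⇒≱ (≤1 t′ q+k∈t′) (begin
      1ℚ                    ≤⟨ ιℕ-mono (ℕ.s≤s (ℕ.z≤n {k})) ⟩
      ιℕ (suc k)            ≡⟨ ℚ.+-identityˡ (ιℕ (suc k)) ⟨
      0ℚ ℚ.+ ιℕ (suc k)     ≤⟨ ℚ.+-monoˡ-≤ (ιℕ (suc k)) 0≤q ⟩
      q ℚ.+ ιℕ (suc k)      ∎))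
      where open ℚ.≤-Reasoning

theorem3p3 : (η η′ : Ω*) → (ν η′ ≪ ν η) ⇔ (η′ ∈ o₋ η)
theorem3p3 η η′ = mk⇔ (≪⇒o₋ η η′) (λ η′∈ → unwrap (o₋⇒≼ η η′ η′∈))
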